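{- Assume $m\in O(n^c)$ for some constant $c$ (and $m\ge n$). For any $0<\epsilon<1$ there is a $(2+\epsilon)$-approximation algorithm for the Distributed Balanced Color Assignment Problem on synchronous rings, i.e. a distributed algorithm computing a Balanced Coloring of cost at most $(2+\epsilon)\,Cost_{OPT}$, with running time $O(n\log_{1+\epsilon}p)$ and message complexity $\Theta(nm)$.
   Context: Problem. There are $n$ agents $a_0,\dots,a_{n-1}$ connected by a ring and a set $\mathcal C$ of $m$ colors $c_0,\dots,c_{m-1}$. The integer $Q_{j,i}\ge 0$ is the number of items of color $c_j$ initially held by $a_i$, and $p=\max_{i,j}Q_{j,i}$. A Balanced Coloring is an assignment $\pi:\{0,\dots,m-1\}\to\{0,\dots,n-1\}$ of colors to agents such that $\lfloor m/n\rfloor$ colors are assigned to $(\lfloor m/n\rfloor+1)n-m$ agents and $\lfloor m/n\rfloor+1$ colors to the remaining $m-\lfloor m/n\rfloor n$ agents. Its cost is $Cost(\pi)=\sum_{j=0}^{m-1}\sum_{i\ne\pi(j)}Q_{j,i}$; $Cost_{OPT}$ is the minimum cost of a Balanced Coloring. At the end each agent must know the colors assigned to it. Model. Agent $a_i$ communicates only with its two neighbors $a_{(i+1)\bmod n}$ and $a_{(i-1)\bmod n}$. Each agent knows $n$, $\mathcal C$ and its own $Q_{j,i}$, but not $p$. There is a global clock; time is counted in rounds, and in each round an agent may check for a message sent in the previous round, compute locally, and send a message. Message complexity is the number of basic messages: a basic message has at most $O(\log n)$ bits and unit cost per link; a message of $L$ bits costs $O(\lceil L/\log n\rceil)$ basic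 messages per link. -}

module Defs where

open import Algebra.Bundles using (CommutativeRing)
import Algebra.Properties.CommutativeMonoid.Sum as CommutativeMonoidSum
import Algebra.Properties.Semiring.Exp as SemiringExp
open import Data.Bool.Base using (Bool; if_then_else_)
open import Data.Fin.Base using (Fin; toℕ)
open import Data.Fin.Properties using (_≟_)
open import Data.Fin.Subset using (Subset; _∈_)
import Data.Integer.Base as ℤ
open import Data.List.Base using (List; length)
open import Data.Maybe using (Maybe; just; nothing; maybe; Is-just)
open import Data.Nat.Base using (ℕ; zero; suc; _+_; _*_; _∸_; _⊔_; _≤_; NonZero)
open import Data.Nat.DivMod using (_/_; _mod_)
open import Data.Nat.Logarithm using (⌊log₂_⌋)
import Data.Nat.Properties as ℕ
open import Data.Product.Base using (_×_; _,_; proj₁; proj₂; ∃)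
open import Data.Rational.Base as ℚ using (ℚ; 0ℚ; 1ℚ)
open import Data.Rational.Properties using (+-*-commutativeRing)
open import Data.Sum.Base using (_⊎_)
open import Data.Vec.Base using (allFin; count)
open import Data.Vec.Functional using (foldr)
open import Function.Bundles using (_⇔_)
open import Relation.Binary.PropositionalEquality.Core using (_≡_)
open import Relation.Nullary.Decidable.Core using (does)
open import Relation.Nullary.Negation.Core using (¬_)

open CommutativeMonoidSum ℕ.+-0-commutativeMonoid public using (sum; sum-syntax)
open SemiringExp (CommutativeRing.semiring +-*-commutativeRing) public
  using () renaming (_^_ to _^ℚ_)

-- Two-sided Dedekind reals: `lower q` means q < x and `upper q` means x < q.
record ℝ : Set₁ where
  field
    lower upper     : ℚ → Set
    lower-inhabited : ∃ lower
    upper-inhabited : ∃ upper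
    lower-rounded   : ∀ q → lower q ⇔ ∃ λ r → q ℚ.< r × lower r
    upper-rounded   : ∀ q → upper q ⇔ ∃ λ r → r ℚ.< q × upper r
    disjoint        : ∀ q → ¬ (lower q × upper q)
    located         : ∀ q r → q ℚ.< r → lower q ⊎ upper r

infix 4 _<ℝ_ _ℝ<_ _≤[2+_]*_ _≤_*log[1+_]_

_<ℝ_ : ℚ → ℝ → Set
q <ℝ x = ℝ.lower x q

_ℝ<_ : ℝ → ℚ → Set
x ℝ< q = ℝ.upper x q

fromℕ : ℕ → ℚ
fromℕ k = ℤ.+ k ℚ./ 1

-- a ≤ (2 + ε) · b, as 2 + ε is the infimum of the rationals 2 + q with ε < q.
_≤[2+_]*_ : ℕ → ℝ → ℕ → Set
a ≤[2+ ε ]* b = ∀ q → ε ℝ< q → fromℕ a ℚ.≤ (fromℕ 2 ℚ.+ q) ℚ.* fromℕ b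

-- t ≤ a · log_{1+ε} x, i.e. (1 + ε) ^ t ≤ x ^ a; meant for ε > 0 and x ≥ 1.
-- (1 + ε) ^ t is the supremum of the (1 + q) ^ t with 0 < q < ε.
_≤_*log[1+_]_ : ℕ → ℕ → ℝ → ℕ → Set
t ≤ a *log[1+ ε ] x =
  ∀ q → 0ℚ ℚ.< q → q <ℝ ε → (1ℚ ℚ.+ q) ^ℚ t ℚ.≤ fromℕ x ^ℚ a

-- Q j i is the number of items of color j initially held by agent i.
Items : ℕ → ℕ → Set
Items n m = Fin m → Fin n → ℕ

Assignment : ℕ → ℕ → Set
Assignment n m = Fin m → Fin n

maxItems : ∀ {n m} → Items n m → ℕ
maxItems Q = foldr _⊔_ 0 λ j → foldr _⊔_ 0 (Q j)

load : ∀ {n m} → Assignment n m → Fin n → ℕ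
load {m = m} π i = count (λ j → π j ≟ i) (allFin m)

agentsWithLoad : ∀ {n m} → Assignment n m → ℕ → ℕ
agentsWithLoad {n} π k = count (λ i → load π i ℕ.≟ k) (allFin n)

-- Neither truncated subtraction truncates.
Balanced : ∀ {n m} .{{_ : NonZero n}} → Assignment n m → Set
Balanced {n} {m} π =
  agentsWithLoad π (m / n)     ≡ (m / n + 1) * n ∸ m ×
  agentsWithLoad π (m / n + 1) ≡ m ∸ m / n * n

cost : ∀ {n m} → Items n m → Assignment n m → ℕ
cost {n} {m} Q π =
  ∑[ j < m ] ∑[ i < n ] (if does (i ≟ π j) then 0 else Q j i)

record IsCostOPT {n m : ℕ} .{{_ : NonZero n}} (Q : Items n m) (opt : ℕ) : Set where
  field
    attained : ∃ λ (σ : Assignment n m) → Balanced σ × cost Q σ ≡ opt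
    minimal  : (σ : Assignment n m) → Balanced σ → opt ≤ cost Q σ

data Side : Set where
  prev next : Side

neighbour : ∀ {n} .{{_ : NonZero n}} → Side → Fin n → Fin n
neighbour {n} next i = (toℕ i + 1) mod n
neighbour {n} prev i = (toℕ i + (n ∸ 1)) mod n

Message : Set
Message = List Bool

-- What an agent sends in one round: at most one message, to one neighbor.
Outgoing : Set
Outgoing = Maybe (Side × Message)

-- `step` is given the current round (the global clock) and the messages sent in
-- the previous round by the two neighbors. An agent has halted once `output` is
-- defined on its state; it then announces the set of colors assigned to it.
record Program (m : ℕ) : Set₁ where
  field
    State  : Set
    start  : (Fin m → ℕ) → State
    step   : ℕ → (Side → Maybe Message) → State → State × Outgoing
    output : State → Maybe (Subset m)

-- An agent's program may depend on n, m and its own name i. Without distinct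
-- names no deterministic algorithm can break the symmetry of the ring.
Algorithm : Set₁
Algorithm = (n m : ℕ) → Fin n → Program m

-- The number of basic messages charged for sending one message over one link.
-- A basic message carries ⌊log₂ n⌋ + 1 bits, and a message with no bits still
-- costs one basic message.
basicMessages : ℕ → Message → ℕ
basicMessages n b = 1 ⊔ ((length b + ⌊log₂ n ⌋) / suc ⌊log₂ n ⌋)

module Execution (𝓐 : Algorithm) {n m : ℕ} .{{_ : NonZero n}} (Q : Items n m) where

  open module P i = Program (𝓐 n m i)

  record Configuration : Set where
    field
      state : (i : Fin n) → State i
      sent  : Fin n → Outgoing

  open Configuration public

  receive : Side → Outgoing → Maybe Message
  receive prev (just (next , b)) = just b
  receive next (just (prev , b)) = just b
  receive _    _                 = nothing

  inbox : Configuration → Fin n → Side → Maybe Message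
  inbox C i s = receive s (sent C (neighbour s i))

  -- A halted agent keeps its state and stays silent.
  activate : ℕ → Configuration → (i : Fin n) → State i × Outgoing
  activate t C i with output i (state C i)
  ... | just _  = state C i , nothing
  ... | nothing = step i t (inbox C i) (state C i)

  -- The configuration after the given number of rounds.
  after : ℕ → Configuration
  after zero .state i  = start i (λ j → Q j i)
  after zero .sent  i  = nothing
  after (suc t) .state i = proj₁ (activate t (after t) i)
  after (suc t) .sent  i = proj₂ (activate t (after t) i)

  Halted : ℕ → Set
  Halted t = ∀ i → Is-just (output i (state (after t) i))

  -- Basic messages sent during rounds 0, …, t - 1.
  messages : ℕ → ℕ
  messages zero    = 0
  messages (suc t) =
    messages t +
    ∑[ i < n ] maybe (λ { (_ , b) → basicMessages n b }) 0 (sent (after (suc t)) i)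

  -- After t rounds every agent has halted and knows π⁻¹ of itself.
  Computes : ℕ → Assignment n m → Set
  Computes t π = ∀ i → ∃ λ (S : Subset m) →
    output i (state (after t) i) ≡ just S × (∀ j → j ∈ S ⇔ π j ≡ i)

open Execution public using (Halted; messages; Computes)

{-# OPTIONS --safe #-}

-- Choose s with 2/s < ε < 6/s. The agents act in turn, agent t % n in round t, so that a rotation
-- takes n rounds, and round the ring they run a greedy algorithm with thresholds (1 + 1/s)^k.
-- The largest threshold needed is found with 2n messages whatever its size: an empty message
-- goes from agent 0 once round the ring, each agent holding it until the thresholds, which grow
-- by a factor 1 + 1/s per rotation, exceed all its items; the rotation in which it comes back is
-- told to everybody during the next one. Then the thresholds decrease again, and in its turn an
-- agent takes the free colors above the current threshold as long as its load permits. The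
-- message under way lists the decisions of the last n turns, so the acting agent always knows
-- all of them, every decision makes n hops, and silence is free.
--
-- Every decision is within a factor 1 + 1/s of the best one available. If o is an optimal
-- coloring and g the computed one, g does much worse than o on a color j only if agent o(j) was
-- full by then. Such colors are charged to those that filled o(j): as the loads of o and g agree
-- up to exchanges between agents with m / n and with m / n + 1 colors, there are enough of them
-- that o gives to another agent, paying for them what g gains.
module Submission where

open import Defs
open import Algebra.Bundles using (CommutativeRing)
import Algebra.Properties.CommutativeMonoid.Sum as CommutativeMonoidSum
import Algebra.Properties.CommutativeSemigroup as CommutativeSemigroupProperties
import Algebra.Properties.Semiring.Exp as SemiringExp
import Algebra.Properties.Semiring.Sum as SemiringSum
open import Data.Bool.Base using (Bool; true; false; if_then_else_)
open import Data.Empty using (⊥)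
open import Data.Fin.Base using (Fin; zero; suc; toℕ; fromℕ<; combine; remQuot)
open import Data.Fin.Properties
  using (_≟_; toℕ<n; fromℕ<-toℕ; toℕ-fromℕ<; toℕ-injective; all?; remQuot-combine)
open import Data.Fin.Subset using (Subset; _∈_)
open import Data.Integer.Base as ℤ using (-[1+_])
import Data.Integer.Properties as ℤ
open import Data.List.Base as List using (List; []; _∷_; _++_; length; filter; concatMap; take; drop)
open import Data.List.Membership.Propositional using () renaming (_∈_ to _∈ˡ_)
open import Data.List.Membership.Propositional.Properties using (∈-allFin)
open import Data.List.Properties
  using (filter-all; filter-none; filter-++; filter-≐; filter-accept; filter-reject; length-++; ++-assoc)
open import Data.List.Relation.Unary.All as All using (All; []; _∷_)
open import Data.List.Relation.Unary.All.Properties using (all-filter; filter⁺)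
open import Data.List.Relation.Unary.Any using (here; there)
open import Data.Maybe using (Is-just)
open import Data.Maybe.Base as Maybe using (Maybe; just; nothing; maybe)
open import Data.Maybe.Properties using (≡-dec; just-injective)
open import Data.Maybe.Relation.Unary.Any using (just)
open import Data.Nat.Base
open import Data.Nat.Divisibility using (n∣m*n)
open import Data.Nat.DivMod
open import Data.Nat.Logarithm using (⌊log₂_⌋; ⌊log₂⌋-mono-≤; ⌊log₂[2^n]⌋≡n)
open import Data.Nat.Properties as ℕ hiding (_≟_)
open import Data.Nat.Tactic.RingSolver using (solve-∀)
open import Data.Product.Base using (Σ; ∃; _×_; _,_; proj₁; proj₂)
open import Data.Rational.Base as ℚ using (ℚ; mkℚ; 0ℚ; 1ℚ; toℚᵘ)
import Data.Rational.Properties as ℚ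
open import Data.Rational.Unnormalised.Base as ℚᵘ using (mkℚᵘ; *≡*; *≤*; *<*)
import Data.Rational.Unnormalised.Properties as ℚᵘ
open import Data.Sum.Base using (_⊎_; inj₁; inj₂; [_,_]′)
open import Data.Unit.Base using (tt)
open import Data.Vec.Base as Vec using (count)
open import Data.Vec.Functional as Vector using ()
open import Data.Vec.Properties using (lookup∘tabulate; []=⇒lookup; lookup⇒[]=)
open import Function.Base using (_∘_; id)
open import Function.Bundles using (Equivalence; mk⇔)
open import Relation.Binary.Definitions using (Tri; tri<; tri≈; tri>)
open import Relation.Binary.PropositionalEquality
open import Relation.Nullary using (¬_; Dec; yes; no; does; contradiction)
open import Relation.Nullary.Decidable using (dec-true; dec-false; decidable-stable; ¬?; _×-dec_; _⊎-dec_)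
open import Relation.Unary using (Decidable; Pred)

open CommutativeMonoidSum ℕ.+-0-commutativeMonoid using (sum-cong-≗; ∑-distrib-+; ∑-comm)
open SemiringSum ℕ.+-*-semiring using (*-distribˡ-sum; *-distribʳ-sum)
open SemiringExp (CommutativeRing.semiring ℚ.+-*-commutativeRing) using (^-assocʳ)

-- Sums and loads

-- The bound on the messages does not depend on `p`, while `p` may be so large that writing down a
-- single `Q j i` already exceeds it. So quantities of items are never transmitted: an agent
-- compares only its own items with a threshold whose index it computes from the global clock. This
-- is also why forwarding nothing must cost nothing: the number of turns grows with `p`.
--
-- The constant `C` is fixed before ε, which forces `s` to be comparable with 1/ε from both sides.
-- The inequality 2/s < ε is what the ratio (2s + 2)/s = 2 + 2/s asks for. The inequality ε < 6/s
-- turns logarithms to the base 1 + 1/s, in which the rotations are counted, into logarithms to the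
-- base 1 + ε at the price of a constant factor.
--
-- In the approximation proof the prices of the agents act like dual variables for the load
-- constraints: with them added, `g` and `o` can be compared color by color, and in the total they
-- can be removed again.

sum-mono : ∀ {k} {f g : Fin k → ℕ} → (∀ i → f i ≤ g i) → sum f ≤ sum g
sum-mono {zero}  f≤g = z≤n
sum-mono {suc k} f≤g = +-mono-≤ (f≤g zero) (sum-mono (f≤g ∘ suc))

sum-rigid : ∀ {k} {f g : Fin k → ℕ} → (∀ i → f i ≤ g i) → sum g ≤ sum f → ∀ i → f i ≡ g i
sum-rigid {suc k} {f} {g} f≤g g≤f zero =
  ≤-antisym (f≤g zero) (+-cancelʳ-≤ (sum (g ∘ suc)) _ _
    (≤-trans g≤f (+-monoʳ-≤ (f zero) (sum-mono (f≤g ∘ suc)))))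
sum-rigid {suc k} {f} {g} f≤g g≤f (suc i) =
  sum-rigid (f≤g ∘ suc) (+-cancelˡ-≤ (g zero) _ _
    (≤-trans g≤f (+-monoˡ-≤ (sum (f ∘ suc)) (f≤g zero)))) i

sum-const : ∀ k c → ∑[ i < k ] c ≡ k * c
sum-const zero    c = refl
sum-const (suc k) c = cong (c +_) (sum-const k c)

term≤sum : ∀ {k} (f : Fin k → ℕ) i → f i ≤ sum f
term≤sum f zero    = m≤m+n _ _
term≤sum f (suc i) = ≤-trans (term≤sum (f ∘ suc) i) (m≤n+m _ _)

sum-zero : ∀ {k} (f : Fin k → ℕ) → (∀ i → f i ≡ 0) → sum f ≡ 0
sum-zero {k} f f≡0 = trans (sum-cong-≗ f≡0) (trans (sum-const k 0) (*-zeroʳ k))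

sum-single : ∀ {k} (f : Fin k → ℕ) i → (∀ j → j ≢ i → f j ≡ 0) → sum f ≡ f i
sum-single f zero    h = trans (cong (f zero +_) (sum-zero (f ∘ suc) λ j → h (suc j) λ ())) (+-identityʳ _)
sum-single f (suc i) h = trans (cong (_+ sum (f ∘ suc)) (h zero λ ()))
  (sum-single (f ∘ suc) i λ j j≢i → h (suc j) λ { refl → j≢i refl })

𝟙 : ∀ {a} {A : Set a} → Dec A → ℕ
𝟙 d = if does d then 1 else 0

𝟙-yes : ∀ {a} {A : Set a} (d : Dec A) → A → 𝟙 d ≡ 1
𝟙-yes d x = cong (if_then 1 else 0) (dec-true d x)

𝟙-no : ∀ {a} {A : Set a} (d : Dec A) → ¬ A → 𝟙 d ≡ 0
𝟙-no d x = cong (if_then 1 else 0) (dec-false d x)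

𝟙≤1 : ∀ {a} {A : Set a} (d : Dec A) → 𝟙 d ≤ 1
𝟙≤1 (yes _) = ≤-refl
𝟙≤1 (no _)  = z≤n

𝟙-mono : ∀ {a b} {A : Set a} {B : Set b} (d : Dec A) (e : Dec B) → (A → B) → 𝟙 d ≤ 𝟙 e
𝟙-mono (yes x) e f = ≤-reflexive (sym (𝟙-yes e (f x)))
𝟙-mono (no _)  e f = z≤n

𝟙-cong : ∀ {a b} {A : Set a} {B : Set b} (d : Dec A) (e : Dec B) → (A → B) → (B → A) → 𝟙 d ≡ 𝟙 e
𝟙-cong d e f g = ≤-antisym (𝟙-mono d e f) (𝟙-mono e d g)

𝟙-exclusive : ∀ {a b} {A : Set a} {B : Set b} (d : Dec A) (e : Dec B) → (A → ¬ B) → 𝟙 d + 𝟙 e ≤ 1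
𝟙-exclusive (yes x) e f = s≤s (≤-reflexive (𝟙-no e (f x)))
𝟙-exclusive (no _)  e f = 𝟙≤1 e

𝟙-exhaustive : ∀ {a b} {A : Set a} {B : Set b} (d : Dec A) (e : Dec B) → 𝟙 d + 𝟙 e ≡ 1 → A ⊎ B
𝟙-exhaustive (yes x) _       _ = inj₁ x
𝟙-exhaustive (no _)  (yes y) _ = inj₂ y

count-tabulate : ∀ {a p k} {A : Set a} {P : A → Set p} (P? : Decidable P) (f : Fin k → A) →
                 count P? (Vec.tabulate f) ≡ ∑[ i < k ] 𝟙 (P? (f i))
count-tabulate {k = zero}  P? f = refl
count-tabulate {k = suc k} P? f with does (P? (f zero))
... | true  = cong suc (count-tabulate P? (f ∘ suc))
... | false = count-tabulate P? (f ∘ suc)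

load-sum : ∀ {n m} (π : Assignment n m) i → load π i ≡ ∑[ j < m ] 𝟙 (π j ≟ i)
load-sum π i = count-tabulate (λ j → π j ≟ i) id

agentsWithLoad-sum : ∀ {n m} (π : Assignment n m) k →
                     agentsWithLoad π k ≡ ∑[ i < n ] 𝟙 (load π i ℕ.≟ k)
agentsWithLoad-sum π k = count-tabulate (λ i → load π i ℕ.≟ k) id

sum-𝟙-≟ : ∀ {k} (i : Fin k) (f : Fin k → ℕ) → ∑[ j < k ] (𝟙 (i ≟ j) * f j) ≡ f i
sum-𝟙-≟ i f = trans
  (sum-single _ i λ j j≢i → cong (_* f j) (𝟙-no (i ≟ j) (≢-sym j≢i)))
  (trans (cong (_* f i) (𝟙-yes (i ≟ i) refl)) (*-identityˡ _))

sum-by-agent : ∀ {n m} (π : Assignment n m) (z : Fin n → ℕ) →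
               ∑[ j < m ] z (π j) ≡ ∑[ i < n ] (load π i * z i)
sum-by-agent {n} {m} π z = begin
  ∑[ j < m ] z (π j)                          ≡⟨ sum-cong-≗ (λ j → sum-𝟙-≟ (π j) z) ⟨
  ∑[ j < m ] ∑[ i < n ] (𝟙 (π j ≟ i) * z i)     ≡⟨ ∑-comm (λ j i → 𝟙 (π j ≟ i) * z i) ⟩
  ∑[ i < n ] ∑[ j < m ] (𝟙 (π j ≟ i) * z i)     ≡⟨ sum-cong-≗ (λ i → *-distribʳ-sum (z i) (λ j → 𝟙 (π j ≟ i))) ⟨
  ∑[ i < n ] (∑[ j < m ] 𝟙 (π j ≟ i) * z i)   ≡⟨ sum-cong-≗ (λ i → cong (_* z i) (sym (load-sum π i))) ⟩
  ∑[ i < n ] (load π i * z i)                   ∎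
  where open ≡-Reasoning

sum-load : ∀ {n m} (π : Assignment n m) → ∑[ i < n ] load π i ≡ m
sum-load {n} {m} π = begin
  ∑[ i < n ] load π i       ≡⟨ sum-cong-≗ (λ i → sym (*-identityʳ (load π i))) ⟩
  ∑[ i < n ] (load π i * 1)   ≡⟨ sum-by-agent π (λ _ → 1) ⟨
  ∑[ j < m ] 1              ≡⟨ sum-const m 1 ⟩
  m * 1                     ≡⟨ *-identityʳ m ⟩
  m                         ∎
  where open ≡-Reasoning

module _ {n m : ℕ} .{{_ : NonZero n}} where

  Light : Assignment n m → Fin n → Set
  Light π i = load π i ≤ m / n

  size-split : n * (m / n) + m % n ≡ m
  size-split = trans (+-comm (n * (m / n)) (m % n))
    (trans (cong (m % n +_) (*-comm n (m / n))) (sym (m≡m%n+[m/n]*n m n)))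

  -- The two prescribed numbers of agents add up to n and no agent is counted in both, so each agent
  -- is counted exactly once.
  balanced⇒load : (π : Assignment n m) → Balanced π → ∀ i →
                  load π i ≡ m / n ⊎ load π i ≡ m / n + 1
  balanced⇒load π (few , many) i =
    𝟙-exhaustive (load π i ℕ.≟ a) (load π i ℕ.≟ a + 1) (one i)
    where
    open ≡-Reasoning
    a = m / n
    r = m % n
    few-count : (a + 1) * n ∸ m ≡ n ∸ r
    few-count = begin
      (a + 1) * n ∸ m           ≡⟨ cong₂ _∸_ (lemma a n) (sym size-split) ⟩
      (n * a + n) ∸ (n * a + r) ≡⟨ [m+n]∸[m+o]≡n∸o (n * a) n r ⟩
      n ∸ r                     ∎
      where
      lemma : ∀ a n → (a + 1) * n ≡ n * a + n
      lemma = solve-∀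
    many-count : m ∸ a * n ≡ r
    many-count = begin
      m ∸ a * n           ≡⟨ cong₂ _∸_ (sym size-split) (*-comm a n) ⟩
      (n * a + r) ∸ n * a ≡⟨ m+n∸m≡n (n * a) r ⟩
      r                   ∎
    e d : Fin n → ℕ
    e i = 𝟙 (load π i ℕ.≟ a)
    d i = 𝟙 (load π i ℕ.≟ a + 1)
    total : sum (λ i → e i + d i) ≡ n
    total = begin
      sum (λ i → e i + d i)  ≡⟨ ∑-distrib-+ e d ⟩
      sum e + sum d          ≡⟨ cong₂ _+_ (agentsWithLoad-sum π a) (agentsWithLoad-sum π (a + 1)) ⟨
      agentsWithLoad π a + agentsWithLoad π (a + 1)
                             ≡⟨ cong₂ _+_ (trans few few-count) (trans many many-count) ⟩
      n ∸ r + r              ≡⟨ m∸n+n≡m (<⇒≤ (m%n<n m n)) ⟩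
      n                      ∎
    one : ∀ i → e i + d i ≡ 1
    one = sum-rigid
      (λ i → 𝟙-exclusive (load π i ℕ.≟ a) (load π i ℕ.≟ a + 1) λ p q →
        m+1+n≢m a (sym (trans (sym p) q)))
      (≤-reflexive (trans (sum-const n 1) (trans (*-identityʳ n) (sym total))))

  heavy-load : Assignment n m → ℕ
  heavy-load π = ∑[ i < n ] 𝟙 (suc (m / n) ℕ.≤? load π i)

  -- A load is at most m / n, plus 1 for a heavy agent. These bounds add up to at most m, the sum of
  -- the loads, so all of them are attained (`sum-rigid`).
  few⇒balanced : (π : Assignment n m) → (∀ i → load π i ≤ suc (m / n)) → heavy-load π ≤ m % n →
                 Balanced π × (∀ i → m / n ≤ load π i) × heavy-load π ≡ m % n
  few⇒balanced π load≤ heavy≤ = (light-count , heavy-count) , a≤load , heavy≡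
    where
    open ≡-Reasoning
    a = m / n
    r = m % n
    h : Fin n → ℕ
    h i = 𝟙 (suc a ℕ.≤? load π i)
    split : sum (λ i → a + h i) ≡ n * a + heavy-load π
    split = trans (∑-distrib-+ (λ _ → a) h) (cong (_+ sum h) (sum-const n a))
    load≤a+h : ∀ i → load π i ≤ a + h i
    load≤a+h i with suc a ℕ.≤? load π i
    ... | yes p = ≤-trans (load≤ i)
        (≤-reflexive (trans (+-comm 1 a) (cong (a +_) (sym (𝟙-yes (suc a ℕ.≤? load π i) p)))))
    ... | no ¬p = ≤-trans (s≤s⁻¹ (≰⇒> ¬p)) (m≤m+n a _)
    load≡a+h : ∀ i → load π i ≡ a + h i
    load≡a+h = sum-rigid load≤a+h (≤-trans (≤-reflexive split)
      (≤-trans (+-monoʳ-≤ (n * a) heavy≤) (≤-reflexive (trans size-split (sym (sum-load π))))))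
    a≤load : ∀ i → a ≤ load π i
    a≤load i = subst (a ≤_) (sym (load≡a+h i)) (m≤m+n a _)
    heavy≡ : heavy-load π ≡ r
    heavy≡ = +-cancelˡ-≡ (n * a) _ _ (begin
      n * a + heavy-load π   ≡⟨ split ⟨
      sum (λ i → a + h i)    ≡⟨ sum-cong-≗ load≡a+h ⟨
      sum (load π)           ≡⟨ sum-load π ⟩
      m                      ≡⟨ size-split ⟨
      n * a + r              ∎)
    heavy-count : agentsWithLoad π (a + 1) ≡ m ∸ a * n
    heavy-count = begin
      agentsWithLoad π (a + 1)   ≡⟨ agentsWithLoad-sum π (a + 1) ⟩
      _                          ≡⟨ sum-cong-≗ (λ i → 𝟙-cong (load π i ℕ.≟ a + 1) (suc a ℕ.≤? load π i)
                                     (λ p → ≤-reflexive (trans (+-comm 1 a) (sym p)))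
                                     (λ p → trans (≤-antisym (load≤ i) p) (+-comm 1 a))) ⟩
      heavy-load π               ≡⟨ heavy≡ ⟩
      r                          ≡⟨ m+n∸m≡n (n * a) r ⟨
      (n * a + r) ∸ n * a        ≡⟨ cong₂ _∸_ size-split (*-comm n a) ⟩
      m ∸ a * n                  ∎
    light : Fin n → ℕ
    light i = 𝟙 (load π i ℕ.≟ a)
    light+h : ∀ i → light i + h i ≡ 1
    light+h i with load π i ℕ.≟ a
    ... | yes p = cong₂ _+_ (𝟙-yes (load π i ℕ.≟ a) p) (𝟙-no (suc a ℕ.≤? load π i) (<⇒≱ (s≤s (≤-reflexive p))))
    ... | no ¬p = cong₂ _+_ (𝟙-no (load π i ℕ.≟ a) ¬p) (𝟙-yes (suc a ℕ.≤? load π i) (≤∧≢⇒< (a≤load i) (≢-sym ¬p)))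
    light-count : agentsWithLoad π a ≡ (a + 1) * n ∸ m
    light-count = begin
      agentsWithLoad π a                    ≡⟨ agentsWithLoad-sum π a ⟩
      sum light                             ≡⟨ m+n∸n≡m (sum light) (sum h) ⟨
      (sum light + sum h) ∸ sum h           ≡⟨ cong (_∸ sum h) (∑-distrib-+ light h) ⟨
      sum (λ i → light i + h i) ∸ sum h     ≡⟨ cong₂ _∸_ (trans
          (sum-cong-≗ light+h) (trans (sum-const n 1) (*-identityʳ n))) heavy≡ ⟩
      n ∸ r                                 ≡⟨ [m+n]∸[m+o]≡n∸o (n * a) n r ⟨
      (n * a + n) ∸ (n * a + r)             ≡⟨ cong₂ _∸_ (lemma a n) size-split ⟩
      (a + 1) * n ∸ m                       ∎
      where
      lemma : ∀ a n → n * a + n ≡ (a + 1) * n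
      lemma = solve-∀

-- The approximation ratio of near-greedy assignments

-- The least value of f on P, or the default W on an empty P.
least : ∀ {k p} {P : Pred (Fin k) p} → Decidable P → (Fin k → ℕ) → ℕ → ℕ
least {zero}  P? f W = W
least {suc k} P? f W = (if does (P? zero) then f zero else W) ⊓ least (P? ∘ suc) (f ∘ suc) W

least≤ : ∀ {k p} {P : Pred (Fin k) p} (P? : Decidable P) f W x → P x → least P? f W ≤ f x
least≤ P? f W zero    Px = ≤-trans (m⊓n≤m _ _) (≤-reflexive (cong (if_then f zero else W) (dec-true (P? zero) Px)))
least≤ P? f W (suc x) Px = ≤-trans (m⊓n≤n _ _) (least≤ (P? ∘ suc) (f ∘ suc) W x Px)

least-preserves : ∀ {k p r} {P : Pred (Fin k) p} (P? : Decidable P) f W (R : ℕ → Set r) →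
                  R W → (∀ x → P x → R (f x)) → R (least P? f W)
least-preserves {zero}  P? f W R RW Rf = RW
least-preserves {suc k} P? f W R RW Rf = [ (λ e → subst R (sym e) head) , (λ e → subst R (sym e) tail) ]′
  (⊓-sel (if does (P? zero) then f zero else W) (least (P? ∘ suc) (f ∘ suc) W))
  where
  head : R (if does (P? zero) then f zero else W)
  head with P? zero
  ... | yes Pz = Rf zero Pz
  ... | no _   = RW
  tail : R (least (P? ∘ suc) (f ∘ suc) W)
  tail = least-preserves (P? ∘ suc) (f ∘ suc) W R RW (Rf ∘ suc)

costOf : ∀ {n} → (Fin n → ℕ) → Fin n → ℕ
costOf {n} q a = ∑[ i < n ] (if does (i ≟ a) then 0 else q i)

costOf-complement : ∀ {n} (q : Fin n → ℕ) a → costOf q a + q a ≡ sum q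
costOf-complement {n} q a = begin
  costOf q a + q a
    ≡⟨ cong (costOf q a +_) (sum-𝟙-≟ a q) ⟨
  costOf q a + ∑[ i < n ] (𝟙 (a ≟ i) * q i)
    ≡⟨ ∑-distrib-+ (λ i → if does (i ≟ a) then 0 else q i) (λ i → 𝟙 (a ≟ i) * q i) ⟨
  ∑[ i < n ] ((if does (i ≟ a) then 0 else q i) + 𝟙 (a ≟ i) * q i)
    ≡⟨ sum-cong-≗ pointwise ⟩
  sum q ∎
  where
  open ≡-Reasoning
  pointwise : ∀ i → (if does (i ≟ a) then 0 else q i) + 𝟙 (a ≟ i) * q i ≡ q i
  pointwise i with i ≟ a | a ≟ i
  ... | yes _   | yes _    = *-identityˡ (q i)
  ... | yes i≡a | no  a≢i  = contradiction (sym i≡a) a≢i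
  ... | no  i≢a | yes a≡i  = contradiction (sym a≡i) i≢a
  ... | no  _   | no  _    = +-identityʳ (q i)

q≤costOf : ∀ {n} (q : Fin n → ℕ) {a i} → i ≢ a → q i ≤ costOf q a
q≤costOf q {a} {i} i≢a = ≤-trans
  (≤-reflexive (sym (cong (if_then 0 else q i) (dec-false (i ≟ a) i≢a))))
  (term≤sum (λ i → if does (i ≟ a) then 0 else q i) i)

module _ {n m : ℕ} .{{_ : NonZero n}} (Q : Items n m) (s : ℕ) (g : Assignment n m)
         (a≤g : ∀ i → m / n ≤ load g i) (g≤a+1 : ∀ i → load g i ≤ suc (m / n))
         where

  Relevant : Fin n → Fin m → Set
  Relevant i k = g k ≡ i ⊎ (Light g i × suc (m / n) ≤ load g (g k))

  -- The price of agent i is the least value realised by g on a color relevant to i. A light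
  -- agent is at most, a heavy agent at least as expensive as the cheapest color of a heavy
  -- agent, so no balanced assignment collects more prices than g.
  near-greedy⇒approx :
    (∀ j k i → Relevant i k → s * Q j i ≤ suc s * Q k (g k) ⊎ s * Q j i ≤ suc s * Q j (g j)) →
    (o : Assignment n m) → Balanced o → s * cost Q g ≤ (2 * s + 2) * cost Q o
  near-greedy⇒approx greedy o o-balanced = +-cancelʳ-≤ (suc s * Z g) _ _ (begin
    s * cost Q g + suc s * Z g
      ≡⟨ sum-linear s g ⟩
    ∑[ j < m ] (s * costOf (Q j) (g j) + suc s * price (g j))
      ≤⟨ sum-mono per-color ⟩
    ∑[ j < m ] ((2 * s + 2) * costOf (Q j) (o j) + suc s * price (o j))
      ≡⟨ sum-linear (2 * s + 2) o ⟨
    (2 * s + 2) * cost Q o + suc s * Z o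
      ≤⟨ +-monoʳ-≤ ((2 * s + 2) * cost Q o) (*-monoʳ-≤ (suc s) Zo≤Zg) ⟩
    (2 * s + 2) * cost Q o + suc s * Z g ∎)
    where
    open ≤-Reasoning

    a = m / n

    value : Fin m → ℕ
    value k = Q k (g k)

    -- The default for minima over empty sets has to dominate every `Q j i`, so that the estimates
    -- of prices below hold for it too.
    W : ℕ
    W = ∑[ j < m ] ∑[ i < n ] Q j i

    heavy? : Decidable (λ k → suc a ≤ load g (g k))
    heavy? k = suc a ℕ.≤? load g (g k)

    relevant? : ∀ i → Decidable (Relevant i)
    relevant? i k = (g k ≟ i) ⊎-dec ((load g i ℕ.≤? a) ×-dec heavy? k)

    price : Fin n → ℕ
    price i = least (relevant? i) value W

    ζ : ℕ
    ζ = least heavy? value W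

    Z : Assignment n m → ℕ
    Z π = ∑[ j < m ] price (π j)

    sum-linear : ∀ c (π : Assignment n m) →
      c * cost Q π + suc s * Z π ≡ ∑[ j < m ] (c * costOf (Q j) (π j) + suc s * price (π j))
    sum-linear c π = trans
      (cong₂ _+_ (*-distribˡ-sum c (λ j → costOf (Q j) (π j))) (*-distribˡ-sum (suc s) (price ∘ π)))
      (sym (∑-distrib-+ (λ j → c * costOf (Q j) (π j)) (λ j → suc s * price (π j))))

    Q≤W : ∀ j i → Q j i ≤ W
    Q≤W j i = ≤-trans (term≤sum (Q j) i) (term≤sum (λ j → sum (Q j)) j)

    price≤value : ∀ j → price (g j) ≤ value j
    price≤value j = least≤ (relevant? (g j)) value W j (inj₁ refl)

    price≤ζ : ∀ i → load g i ≤ a → price i ≤ ζ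
    price≤ζ i light = least-preserves heavy? value W (price i ≤_)
      (least-preserves (relevant? i) value W (_≤ W) ≤-refl (λ k _ → Q≤W k (g k)))
      (λ k heavy → least≤ (relevant? i) value W k (inj₂ (light , heavy)))

    ζ≤price : ∀ i → suc a ≤ load g i → ζ ≤ price i
    ζ≤price i heavy = least-preserves (relevant? i) value W (ζ ≤_)
      (least-preserves heavy? value W (_≤ W) ≤-refl (λ k _ → Q≤W k (g k)))
      λ { k (inj₁ refl)        → least≤ heavy? value W k heavy
        ; k (inj₂ (light , _)) → contradiction heavy (≤⇒≯ light) }

    o-load : ∀ i → a ≤ load o i × load o i ≤ suc a
    o-load i with balanced⇒load o o-balanced i
    ... | inj₁ p = ≤-reflexive (sym p) , ≤-trans (≤-reflexive p) (n≤1+n a)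
    ... | inj₂ p = ≤-trans (m≤m+n a 1) (≤-reflexive (sym p)) , ≤-reflexive (trans p (+-comm a 1))

    rearrange : ∀ {x y u v} → x ≤ y → u ≤ v → y * u + x * v ≤ x * u + y * v
    rearrange {x} {y} {u} {v} x≤y u≤v with m≤n⇒∃[o]m+o≡n x≤y | m≤n⇒∃[o]m+o≡n u≤v
    ... | d , refl | e , refl = ≤-trans (m≤m+n _ (d * e)) (≤-reflexive (lemma x d u e))
      where
      lemma : ∀ x d u e → (x + d) * u + x * (u + e) + d * e ≡ x * u + (x + d) * (u + e)
      lemma = solve-∀

    -- (load o i - load g i) * (price i - ζ) ≤ 0 without subtraction: the factors have opposite
    -- signs both for light and for heavy agents of `g`. In the sum over the agents the terms with ζ
    -- cancel, as both loads add up to m.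
    exchange : ∀ i → load o i * price i + load g i * ζ ≤ load g i * price i + load o i * ζ
    exchange i = [ light-case , heavy-case ]′ (≤-<-connex (load g i) a)
      where
      light-case : load g i ≤ a → _
      light-case light = rearrange (≤-trans light (proj₁ (o-load i))) (price≤ζ i light)
      heavy-case : a < load g i → _
      heavy-case heavy = begin
        load o i * price i + load g i * ζ ≡⟨ +-comm (load o i * price i) _ ⟩
        load g i * ζ + load o i * price i
          ≤⟨ rearrange (≤-trans (proj₂ (o-load i)) heavy) (ζ≤price i heavy) ⟩
        load o i * ζ + load g i * price i ≡⟨ +-comm (load o i * ζ) _ ⟩
        load g i * price i + load o i * ζ ∎

    agents-total : ∀ (π σ : Assignment n m) →
      ∑[ i < n ] (load π i * price i + load σ i * ζ) ≡ Z π + m * ζ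
    agents-total π σ = trans
      (∑-distrib-+ (λ i → load π i * price i) (λ i → load σ i * ζ))
      (cong₂ _+_ (sym (sum-by-agent π price))
        (trans (sym (*-distribʳ-sum ζ (load σ))) (cong (_* ζ) (sum-load σ))))

    Zo≤Zg : Z o ≤ Z g
    Zo≤Zg = +-cancelʳ-≤ (m * ζ) _ _ (begin
      Z o + m * ζ                                         ≡⟨ agents-total o g ⟨
      ∑[ i < n ] (load o i * price i + load g i * ζ)      ≤⟨ sum-mono exchange ⟩
      ∑[ i < n ] (load g i * price i + load o i * ζ)      ≡⟨ agents-total g o ⟩
      Z g + m * ζ                                         ∎)

    near : ∀ j i → s * Q j i ≤ suc s * price i ⊎ s * Q j i ≤ suc s * value j
    -- Testing the alternative without `k` first: if it fails, `greedy` gives the other one for all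
    -- relevant `k`, hence for their minimum.
    near j i with s * Q j i ℕ.≤? suc s * value j
    ... | yes p = inj₂ p
    ... | no ¬p = inj₁ (least-preserves (relevant? i) value W (λ z → s * Q j i ≤ suc s * z)
        (*-mono-≤ (n≤1+n s) (Q≤W j i))
        (λ k rel → [ id , (λ p → contradiction p ¬p) ]′ (greedy j k i rel)))

    -- Where `o` and `g` disagree, `o` pays `w`, and this is used twice: against the price of `g j`
    -- and in `v-bound`. Hence the factor 2 in the ratio.
    per-color : ∀ j → s * costOf (Q j) (g j) + suc s * price (g j) ≤
                      (2 * s + 2) * costOf (Q j) (o j) + suc s * price (o j)
    per-color j with o j ≟ g j
    ... | yes oj≡gj rewrite oj≡gj = +-monoˡ-≤ (suc s * price (g j))
      (*-monoˡ-≤ (costOf (Q j) (g j)) (≤-trans (m≤m+n s _) (m≤m+n (2 * s) 2)))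
    ... | no oj≢gj with m≤n⇒∃[o]m+o≡n (q≤costOf (Q j) {o j} {g j} (≢-sym oj≢gj))
    ... | R , w+R≡co = begin
      s * costOf (Q j) (g j) + suc s * price (g j)
        ≤⟨ +-monoʳ-≤ (s * costOf (Q j) (g j)) (*-monoʳ-≤ (suc s) (price≤value j)) ⟩
      s * costOf (Q j) (g j) + suc s * w
        ≡⟨ cong (λ c → s * c + suc s * w) cg≡ ⟩
      s * (R + v) + suc s * w
        ≡⟨ cong (_+ suc s * w) (*-distribˡ-+ s R v) ⟩
      s * R + s * v + suc s * w
        ≤⟨ +-monoˡ-≤ (suc s * w) (+-monoʳ-≤ (s * R) v-bound) ⟩
      s * R + (suc s * price (o j) + suc s * w) + suc s * w
        ≤⟨ m≤m+n _ ((s + 2) * R) ⟩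
      s * R + (suc s * price (o j) + suc s * w) + suc s * w + (s + 2) * R
        ≡⟨ lemma s R w (price (o j)) ⟩
      (2 * s + 2) * (w + R) + suc s * price (o j)
        ≡⟨ cong (λ c → (2 * s + 2) * c + suc s * price (o j)) w+R≡co ⟩
      (2 * s + 2) * costOf (Q j) (o j) + suc s * price (o j) ∎
      where
      w = Q j (g j)
      v = Q j (o j)
      cg≡ : costOf (Q j) (g j) ≡ R + v
      cg≡ = +-cancelʳ-≡ w _ _ (trans (trans (costOf-complement (Q j) (g j))
        (trans (sym (costOf-complement (Q j) (o j))) (cong (_+ v) (sym w+R≡co)))) (swap w R v))
        where
        swap : ∀ w R v → w + R + v ≡ R + v + w
        swap = solve-∀
      v-bound : s * v ≤ suc s * price (o j) + suc s * w
      v-bound = [ (λ p → ≤-trans p (m≤m+n _ _)) ,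
          (λ p → ≤-trans p (m≤n+m (suc s * w) (suc s * price (o j)))) ]′ (near j (o j))
      lemma : ∀ s R w z → s * R + (suc s * z + suc s * w) + suc s * w + (s + 2) * R ≡
                          (2 * s + 2) * (w + R) + suc s * z
      lemma = solve-∀

sum-strict : ∀ {k} {f g : Fin k → ℕ} → (∀ i → f i ≤ g i) → ∀ i → f i < g i → sum f < sum g
sum-strict f≤g i fi<gi = ≰⇒> λ g≤f → <⇒≢ fi<gi (sum-rigid f≤g g≤f i)

sum-𝟙 : ∀ {k} (i : Fin k) → ∑[ j < k ] 𝟙 (i ≟ j) ≡ 1
sum-𝟙 {k} i = trans (sum-cong-≗ {k} λ j → sym (*-identityʳ (𝟙 (i ≟ j)))) (sum-𝟙-≟ i (λ _ → 1))

𝟙-strict : ∀ {a b} {A : Set a} {B : Set b} (d : Dec A) (e : Dec B) → ¬ A → B → 𝟙 d < 𝟙 e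
𝟙-strict d e ¬x y = ≤-reflexive (trans (cong suc (𝟙-no d ¬x)) (sym (𝟙-yes e y)))

-- Partial assignments

-- A partial assignment is the list of its decisions, the latest first.
Entry : ℕ → ℕ → Set
Entry n m = Fin m × Fin n

module _ {n m : ℕ} where

  lookup : Fin m → List (Entry n m) → Maybe (Fin n)
  lookup j []             = nothing
  lookup j ((c , i) ∷ es) with j ≟ c
  ... | yes _ = just i
  ... | no _  = lookup j es

  Free : Fin m → List (Entry n m) → Set
  Free j es = lookup j es ≡ nothing

  Complete : List (Entry n m) → Set
  Complete es = ∀ j → ∃ λ i → lookup j es ≡ just i

  owned? : ∀ es i → Decidable (λ j → lookup j es ≡ just i)
  owned? es i j = ≡-dec _≟_ (lookup j es) (just i)

  free? : ∀ es → Decidable (λ j → Free j es)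
  free? es j = ≡-dec _≟_ (lookup j es) nothing

  partialLoad : List (Entry n m) → Fin n → ℕ
  partialLoad es i = ∑[ j < m ] 𝟙 (owned? es i j)

  lookup-head : ∀ j i es → lookup j ((j , i) ∷ es) ≡ just i
  lookup-head j i es with j ≟ j
  ... | yes _  = refl
  ... | no j≢j = contradiction refl j≢j

  lookup-tail : ∀ {j c} i es → j ≢ c → lookup j ((c , i) ∷ es) ≡ lookup j es
  lookup-tail {j} {c} i es j≢c with j ≟ c
  ... | yes j≡c = contradiction j≡c j≢c
  ... | no _    = refl

  free-tail : ∀ {j c i} es → Free j ((c , i) ∷ es) → j ≢ c × Free j es
  free-tail {j} {c} es free with j ≟ c
  ... | no j≢c = j≢c , free

  lookup-persists : ∀ {j c i x} es → Free c es → lookup j es ≡ just x →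
                    lookup j ((c , i) ∷ es) ≡ just x
  lookup-persists {j} {c} es free p with j ≟ c
  ... | no _     = p
  ... | yes refl with () ← trans (sym free) p

  -- If `j` were not free, the new entry would hide the old one, whose owner could lose a color.
  partialLoad-∷ : ∀ {j i} es → Free j es → ∀ x →
                  partialLoad ((j , i) ∷ es) x ≡ 𝟙 (i ≟ x) + partialLoad es x
  partialLoad-∷ {j} {i} es free x = begin
    ∑[ c < m ] 𝟙 (owned? ((j , i) ∷ es) x c)
      ≡⟨ sum-cong-≗ pointwise ⟩
    ∑[ c < m ] (𝟙 (j ≟ c) * 𝟙 (i ≟ x) + 𝟙 (owned? es x c))
      ≡⟨ ∑-distrib-+ (λ c → 𝟙 (j ≟ c) * 𝟙 (i ≟ x)) (λ c → 𝟙 (owned? es x c)) ⟩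
    ∑[ c < m ] (𝟙 (j ≟ c) * 𝟙 (i ≟ x)) + partialLoad es x
      ≡⟨ cong (_+ partialLoad es x) (sum-𝟙-≟ j (λ _ → 𝟙 (i ≟ x))) ⟩
    𝟙 (i ≟ x) + partialLoad es x ∎
    where
    open ≡-Reasoning
    pointwise : ∀ c → 𝟙 (owned? ((j , i) ∷ es) x c) ≡ 𝟙 (j ≟ c) * 𝟙 (i ≟ x) + 𝟙 (owned? es x c)
    pointwise c = go (j ≟ c)
      where
      go : Dec (j ≡ c) → 𝟙 (owned? ((j , i) ∷ es) x c) ≡ 𝟙 (j ≟ c) * 𝟙 (i ≟ x) + 𝟙 (owned? es x c)
      go (yes refl) = begin
        𝟙 (owned? ((j , i) ∷ es) x j)
          ≡⟨ 𝟙-cong (owned? ((j , i) ∷ es) x j) (i ≟ x)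
               (λ p → just-injective (trans (sym (lookup-head j i es)) p))
               (λ { refl → lookup-head j i es }) ⟩
        𝟙 (i ≟ x)                                       ≡⟨ +-identityʳ _ ⟨
        𝟙 (i ≟ x) + 0                                   ≡⟨ +-identityʳ _ ⟨
        𝟙 (i ≟ x) + 0 + 0
          ≡⟨ cong₂ (λ u v → u * 𝟙 (i ≟ x) + v) (𝟙-yes (j ≟ j) refl)
               (𝟙-no (owned? es x j) (λ p → contradiction (trans (sym free) p) λ ())) ⟨
        𝟙 (j ≟ j) * 𝟙 (i ≟ x) + 𝟙 (owned? es x j)       ∎
      go (no j≢c) = trans
        (𝟙-cong (owned? ((j , i) ∷ es) x c) (owned? es x c)
          (trans (sym tail)) (trans tail))
        (cong (λ u → u * 𝟙 (i ≟ x) + 𝟙 (owned? es x c)) (sym (𝟙-no (j ≟ c) j≢c)))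
        where
        tail : lookup c ((j , i) ∷ es) ≡ lookup c es
        tail = lookup-tail i es (≢-sym j≢c)

  assigned≤1 : ∀ (o : Maybe (Fin n)) → ∑[ i < n ] 𝟙 (≡-dec _≟_ o (just i)) ≤ 1
  assigned≤1 nothing  = ≤-trans (≤-reflexive (sum-zero {n} _ λ i → refl)) z≤n
  assigned≤1 (just x) = ≤-trans
    (≤-reflexive (sum-single _ x λ i i≢x → 𝟙-no (≡-dec _≟_ (just x) (just i)) λ { refl → i≢x refl }))
    (𝟙≤1 (≡-dec _≟_ (just x) (just x)))

  sum-partialLoad : ∀ es → ∑[ i < n ] partialLoad es i ≡ ∑[ j < m ] ∑[ i < n ] 𝟙 (owned? es i j)
  sum-partialLoad es = ∑-comm (λ i j → 𝟙 (owned? es i j))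

  sum-partialLoad< : ∀ {j} es → Free j es → ∑[ i < n ] partialLoad es i < m
  sum-partialLoad< {j} es free = subst₂ _<_ (sym (sum-partialLoad es))
    (trans (sum-const m 1) (*-identityʳ m))
    (sum-strict (λ j → assigned≤1 (lookup j es)) j
      (s≤s (≤-reflexive (sum-zero {n} _ λ i →
        𝟙-no (owned? es i j) λ p → contradiction (trans (sym p) free) λ ()))))

  total : ∀ es → Complete es → Assignment n m
  total es complete j = proj₁ (complete j)

  load-total : ∀ es (complete : Complete es) i → load (total es complete) i ≡ partialLoad es i
  load-total es complete i = trans (load-sum (total es complete) i)
    (sum-cong-≗ λ j → 𝟙-cong (total es complete j ≟ i) (owned? es i j)
      (λ { refl → proj₂ (complete j) })
      (λ p → just-injective (trans (sym (proj₂ (complete j))) p)))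

  Extends : Assignment n m → List (Entry n m) → Set
  Extends g es = ∀ c x → lookup c es ≡ just x → g c ≡ x

  partialLoad≤load : ∀ {g} es → Extends g es → ∀ x → partialLoad es x ≤ load g x
  partialLoad≤load {g} es ext x = ≤-trans
    (sum-mono λ c → 𝟙-mono (owned? es x c) (g c ≟ x) (ext c x))
    (≤-reflexive (sym (load-sum g x)))

  partialLoad<load : ∀ {g k} es → Extends g es → Free k es → partialLoad es (g k) < load g (g k)
  partialLoad<load {g} {k} es ext free = ≤-trans
    (sum-strict (λ c → 𝟙-mono (owned? es (g k) c) (g c ≟ g k) (ext c (g k))) k
      (𝟙-strict (owned? es (g k) k) (g k ≟ g k) (λ p → contradiction (trans (sym p) free) λ ()) refl))
    (≤-reflexive (sym (load-sum g (g k))))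

-- Capacities of the agents and near-greedy runs

module _ {n m : ℕ} .{{_ : NonZero n}} where

  private
    quota excess : ℕ
    quota  = m / n
    excess = m % n

  heavyAgents : List (Entry n m) → ℕ
  heavyAgents es = ∑[ i < n ] 𝟙 (suc (m / n) ℕ.≤? partialLoad es i)

  -- The right to a load of m / n + 1 goes to the first m % n agents that use it: fixing these
  -- agents in advance would spoil the approximation ratio.
  Open : List (Entry n m) → Fin n → Set
  Open es i = partialLoad es i < m / n ⊎ (partialLoad es i ≤ m / n × heavyAgents es < m % n)

  open? : ∀ es → Decidable (Open es)
  open? es i = (partialLoad es i ℕ.<? m / n) ⊎-dec
               ((partialLoad es i ℕ.≤? m / n) ×-dec (heavyAgents es ℕ.<? m % n))

  open⇒load≤ : ∀ es i → Open es i → partialLoad es i ≤ quota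
  open⇒load≤ es i = [ <⇒≤ , proj₁ ]′

  partialLoad-grows : ∀ j i (es : List (Entry n m)) → Free j es → ∀ x →
      partialLoad es x ≤ partialLoad ((j , i) ∷ es) x
  partialLoad-grows j i es free x = ≤-trans (m≤n+m (partialLoad es x) (𝟙 (i ≟ x)))
    (≤-reflexive (sym (partialLoad-∷ {j = j} {i} es free x)))

  heavy-grows : ∀ j i (es : List (Entry n m)) → Free j es → heavyAgents es ≤ heavyAgents ((j , i) ∷ es)
  heavy-grows j i es free = sum-mono λ x →
    𝟙-mono (suc quota ℕ.≤? partialLoad es x) (suc quota ℕ.≤? partialLoad ((j , i) ∷ es) x)
      λ p → ≤-trans p (partialLoad-grows j i es free x)

  -- Loads and the number of heavy agents only grow, so a closed agent never reopens.
  open-tail : ∀ j i (es : List (Entry n m)) → Free j es → ∀ x → Open ((j , i) ∷ es) x → Open es x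
  open-tail j i es free x (inj₁ p) = inj₁ (≤-<-trans (partialLoad-grows j i es free x) p)
  open-tail j i es free x (inj₂ (p , q)) =
    inj₂ (≤-trans (partialLoad-grows j i es free x) p , ≤-<-trans (heavy-grows j i es free) q)

  -- A closed agent has at least m / n colors, and more if one of the m % n rights is left. None is
  -- left, since otherwise all n agents would be heavy, and n > m % n. This is why a greedy run
  -- cannot get stuck while a color is free.
  closed⇒sum≥ : ∀ es → (∀ i → ¬ Open es i) → m ≤ ∑[ i < n ] partialLoad es i
  closed⇒sum≥ es closed = begin
    m                            ≡⟨ size-split {n} {m} ⟨
    n * quota + excess                    ≤⟨ +-monoʳ-≤ (n * quota) excess≤heavy ⟩
    n * quota + heavyAgents es       ≡⟨ cong (_+ heavyAgents es) (sum-const n quota) ⟨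
    sum {n} (λ _ → quota) + heavyAgents es
                                 ≡⟨ ∑-distrib-+ (λ _ → quota) h ⟨
    sum (λ i → quota + h i)          ≤⟨ sum-mono quota+h≤load ⟩
    sum (partialLoad es)         ∎
    where
    open ≤-Reasoning
    h : Fin n → ℕ
    h i = 𝟙 (suc quota ℕ.≤? partialLoad es i)
    quota≤load : ∀ i → quota ≤ partialLoad es i
    quota≤load i = ≮⇒≥ (closed i ∘ inj₁)
    quota+h≤load : ∀ i → quota + h i ≤ partialLoad es i
    quota+h≤load i = [ light-case , heavy-case ]′ (≤-<-connex (partialLoad es i) quota)
      where
      light-case : partialLoad es i ≤ quota → quota + h i ≤ partialLoad es i
      light-case p = ≤-trans (≤-reflexive (trans (cong (quota +_)
          (𝟙-no (suc quota ℕ.≤? partialLoad es i) (≤⇒≯ p))) (+-identityʳ quota))) (quota≤load i)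
      heavy-case : quota < partialLoad es i → quota + h i ≤ partialLoad es i
      heavy-case p = ≤-trans (≤-trans
          (+-monoʳ-≤ quota (𝟙≤1 (suc quota ℕ.≤? partialLoad es i))) (≤-reflexive (+-comm quota 1))) p
    excess≤heavy : excess ≤ heavyAgents es
    excess≤heavy = ≮⇒≥ λ heavy<r → <⇒≱ (<-trans heavy<r (m%n<n m n)) (begin
      n              ≡⟨ trans (sum-const n 1) (*-identityʳ n) ⟨
      sum {n} (λ _ → 1)  ≡⟨ sum-cong-≗ (λ i → sym (𝟙-yes (suc quota ℕ.≤? partialLoad es i)
                          (≰⇒> λ p → closed i (inj₂ (p , heavy<r))))) ⟩
      heavyAgents es ∎)

  open-before : ∀ {g : Assignment n m} {k i} es → (∀ i → load g i ≤ suc quota) → heavy-load g ≤ excess →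
                Extends g es → Free k es → g k ≡ i ⊎ (Light g i × suc quota ≤ load g (g k)) → Open es i
  open-before {g} {k} {i} es g≤ heavy≤ ext free rel with <-cmp (partialLoad es i) quota
  ... | tri< lt _ _ = inj₁ lt
  ... | tri≈ _ eq _ = inj₂ (≤-reflexive eq , <-≤-trans heavy< heavy≤)
    where
    gk-heavy : suc quota ≤ load g (g k)
    gk-heavy = [ (λ { refl → subst (_< load g (g k)) eq (partialLoad<load es ext free) }) , proj₂ ]′ rel
    heavy< : heavyAgents es < heavy-load g
    heavy< = sum-strict
      (λ x → 𝟙-mono (suc quota ℕ.≤? partialLoad es x) (suc quota ℕ.≤? load g x)
        λ p → ≤-trans p (partialLoad≤load es ext x))
      (g k)
      (𝟙-strict (suc quota ℕ.≤? partialLoad es (g k)) (suc quota ℕ.≤? load g (g k))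
        (λ p → <⇒≱ (partialLoad<load es ext free) (≤-trans (g≤ (g k)) p)) gk-heavy)
  ... | tri> _ _ gt = contradiction
    ([ (λ { refl → ≤-trans (partialLoad<load es ext free) (g≤ i) })
     , (λ (light , _) → s≤s (≤-trans (partialLoad≤load es ext i) light)) ]′ rel)
    (<⇒≱ (s≤s gt))

  -- Sequences of decisions, each of value at least s / (s + 1) times the largest value available.
  data NearGreedy (Q : Items n m) (s : ℕ) : List (Entry n m) → Set where
    []  : NearGreedy Q s []
    add : ∀ {es j i} → NearGreedy Q s es → Free j es → Open es i →
          (∀ j′ i′ → Free j′ es → Open es i′ → s * Q j′ i′ ≤ suc s * Q j i) →
          NearGreedy Q s ((j , i) ∷ es)

  module _ {Q : Items n m} {s : ℕ} where

    length≡sum-load : ∀ {es} → NearGreedy Q s es → length es ≡ ∑[ i < n ] partialLoad es i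
    length≡sum-load []                             = sym (sum-zero {n} _ λ i → sum-zero {m} _ λ j → refl)
    length≡sum-load (add {es} {j} {i} run free _ _) = sym (begin
      ∑[ x < n ] partialLoad ((j , i) ∷ es) x      ≡⟨ sum-cong-≗ (partialLoad-∷ es free) ⟩
      ∑[ x < n ] (𝟙 (i ≟ x) + partialLoad es x)    ≡⟨ ∑-distrib-+ (λ x → 𝟙 (i ≟ x)) (partialLoad es) ⟩
      ∑[ x < n ] 𝟙 (i ≟ x) + sum (partialLoad es)  ≡⟨ cong₂ _+_ (sum-𝟙 i) (sym (length≡sum-load run)) ⟩
      suc (length es)                              ∎)
      where open ≡-Reasoning

    load≤ : ∀ {es} → NearGreedy Q s es → ∀ i → partialLoad es i ≤ suc quota
    load≤ [] i = ≤-trans (≤-reflexive (sum-zero {m} _ λ j → refl)) z≤n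
    load≤ (add {es} {j} {x} run free open-x _) i =
      ≤-trans (≤-reflexive (partialLoad-∷ es free i)) (go (x ≟ i))
      where
      go : Dec (x ≡ i) → 𝟙 (x ≟ i) + partialLoad es i ≤ suc quota
      go (yes refl) = +-mono-≤ (𝟙≤1 (x ≟ x)) (open⇒load≤ es x open-x)
      go (no x≢i)   = subst (λ u → u + partialLoad es i ≤ suc quota) (sym (𝟙-no (x ≟ i) x≢i)) (load≤ run i)

    heavy≤ : ∀ {es} → NearGreedy Q s es → heavyAgents es ≤ excess
    heavy≤ [] = ≤-trans (≤-reflexive (sum-zero {n} _ λ i →
      𝟙-no (suc quota ℕ.≤? partialLoad {n} {m} [] i) (λ p → <⇒≱ (≤-trans (s≤s z≤n) p)
          (≤-reflexive (sum-zero {m} (λ j → 𝟙 (owned? {n} {m} [] i j)) λ j → refl))))) z≤n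
    -- From below m / n, one color leads at most to m / n: no agent becomes heavy.
    heavy≤ (add {es} {j} {i} run free (inj₁ lt) _) = ≤-trans (sum-mono no-new) (heavy≤ run)
      where
      no-new : ∀ x → 𝟙 (suc quota ℕ.≤? partialLoad ((j , i) ∷ es) x) ≤ 𝟙 (suc quota ℕ.≤? partialLoad es x)
      no-new x = 𝟙-mono (suc quota ℕ.≤? partialLoad ((j , i) ∷ es) x)
          (suc quota ℕ.≤? partialLoad es x) λ p → go p (i ≟ x)
        where
        go : suc quota ≤ partialLoad ((j , i) ∷ es) x → Dec (i ≡ x) → suc quota ≤ partialLoad es x
        go p (yes refl) = contradiction (≤-trans p (≤-reflexive (partialLoad-∷ es free i)))
          (<⇒≱ (s≤s (≤-trans (+-monoˡ-≤ (partialLoad es i) (𝟙≤1 (i ≟ i))) lt)))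
        go p (no i≢x) = ≤-trans p (≤-reflexive (trans (partialLoad-∷ es free x)
          (cong (_+ partialLoad es x) (𝟙-no (i ≟ x) i≢x))))
    heavy≤ (add {es} {j} {i} run free (inj₂ (_ , lt)) _) = ≤-trans one-new lt
      where
      one-new : heavyAgents ((j , i) ∷ es) ≤ suc (heavyAgents es)
      one-new = ≤-trans (sum-mono at)
        (≤-reflexive (trans (∑-distrib-+ (λ x → 𝟙 (i ≟ x)) (λ x → 𝟙 (suc quota ℕ.≤? partialLoad es x)))
          (cong (_+ heavyAgents es) (sum-𝟙 i))))
        where
        at : ∀ x → 𝟙 (suc quota ℕ.≤? partialLoad ((j , i) ∷ es) x) ≤ 𝟙 (i ≟ x) + 𝟙 (suc quota ℕ.≤? partialLoad es x)
        at x = go (i ≟ x)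
          where
          go : Dec (i ≡ x) → 𝟙 (suc quota ℕ.≤? partialLoad ((j , i) ∷ es) x) ≤
              𝟙 (i ≟ x) + 𝟙 (suc quota ℕ.≤? partialLoad es x)
          go (yes i≡x) = ≤-trans (𝟙≤1 (suc quota ℕ.≤? partialLoad ((j , i) ∷ es) x))
            (≤-trans (≤-reflexive (sym (𝟙-yes (i ≟ x) i≡x))) (m≤m+n _ _))
          go (no i≢x) = ≤-trans
            (𝟙-mono (suc quota ℕ.≤? partialLoad ((j , i) ∷ es) x) (suc quota ℕ.≤? partialLoad es x)
              λ p → ≤-trans p (≤-reflexive (trans (partialLoad-∷ es free x)
                (cong (_+ partialLoad es x) (𝟙-no (i ≟ x) i≢x)))))
            (m≤n+m _ _)

    -- Whichever of j and k is decided first is decided while (j , i) is available.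
    first-decision : ∀ {es g} → NearGreedy Q s es → Extends g es →
      (∀ i → load g i ≤ suc quota) → heavy-load g ≤ excess →
      ∀ {j k i} → g k ≡ i ⊎ (Light g i × suc quota ≤ load g (g k)) →
      ¬ (Free j es × Free k es) →
      s * Q j i ≤ suc s * Q k (g k) ⊎ s * Q j i ≤ suc s * Q j (g j)
    first-decision [] ext g≤ heavy≤ rel ¬free = contradiction (refl , refl) ¬free
    first-decision {g = g} (add {es} {c} {x} run free open-x near) ext g≤ heavy≤ {j} {k} {i} rel ¬free =
      decide (free? es j) (free? es k)
      where
      Goal = s * Q j i ≤ suc s * Q k (g k) ⊎ s * Q j i ≤ suc s * Q j (g j)
      ext′ : Extends g es
      ext′ d y p = ext d y (lookup-persists es free p)
      decide : Dec (Free j es) → Dec (Free k es) → Goal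
      decide (no ¬fj) _ = first-decision run ext′ g≤ heavy≤ rel (¬fj ∘ proj₁)
      decide _ (no ¬fk) = first-decision run ext′ g≤ heavy≤ rel (¬fk ∘ proj₂)
      decide (yes fj) (yes fk) = now (j ≟ c) (k ≟ c)
        where
        best : s * Q j i ≤ suc s * Q c (g c)
        best = subst (λ y → s * Q j i ≤ suc s * Q c y) (sym (ext c x (lookup-head c x es)))
          (near j i fj (open-before es g≤ heavy≤ ext′ fk rel))
        now : Dec (j ≡ c) → Dec (k ≡ c) → Goal
        now (yes refl) _          = inj₂ best
        now (no _)     (yes refl) = inj₁ best
        now (no j≢c)   (no k≢c)   = contradiction
          (trans (lookup-tail x es j≢c) fj , trans (lookup-tail x es k≢c) fk) ¬free

    exhausted⇒complete : ∀ es → (∀ j i → Free j es → ¬ Open es i) → Complete es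
    exhausted⇒complete es exhausted j with lookup j es in eq
    ... | just i  = i , refl
    ... | nothing = contradiction (closed⇒sum≥ es (λ i → exhausted j i eq)) (<⇒≱ (sum-partialLoad< es eq))

    module _ {es : List (Entry n m)} (run : NearGreedy Q s es) (complete : Complete es) where

      private
        g : Assignment n m
        g = total es complete

        g-load≤ : ∀ i → load g i ≤ suc quota
        g-load≤ i = ≤-trans (≤-reflexive (load-total es complete i)) (load≤ run i)

        g-heavy≤ : heavy-load g ≤ excess
        g-heavy≤ = ≤-trans (sum-mono λ i →
          𝟙-mono (suc quota ℕ.≤? load g i) (suc quota ℕ.≤? partialLoad es i)
            λ p → ≤-trans p (≤-reflexive (load-total es complete i))) (heavy≤ run)

      run-balanced : Balanced g
      run-balanced = proj₁ (few⇒balanced g g-load≤ g-heavy≤)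

      run-length : length es ≡ m
      run-length = trans (length≡sum-load run)
        (trans (sum-cong-≗ λ i → sym (load-total es complete i)) (sum-load g))

      run-approx : (o : Assignment n m) → Balanced o → s * cost Q g ≤ (2 * s + 2) * cost Q o
      run-approx = near-greedy⇒approx Q s g (proj₁ (proj₂ (few⇒balanced g g-load≤ g-heavy≤))) g-load≤
        λ j k i rel → first-decision run
          (λ c x p → just-injective (trans (sym (proj₂ (complete c))) p)) g-load≤ g-heavy≤ rel
          λ (fj , _) → absurd (trans (sym fj) (proj₂ (complete j)))
        where
        absurd : ∀ {i : Fin n} → nothing ≡ just i → _
        absurd ()

  -- The pairs that can still be decided only disappear, so a bound of this kind survives every
  -- decision, whatever `P` is.
  Bounded : (Fin m → Fin n → Set) → List (Entry n m) → Set
  Bounded P es = ∀ j i → Free j es → Open es i → P j i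

  bounded-∷ : ∀ {P : Fin m → Fin n → Set} {j i} es → Free j es → Bounded P es → Bounded P ((j , i) ∷ es)
  bounded-∷ {j = j} {i} es free bounded j′ i′ free′ open′ =
    bounded j′ i′ (proj₂ (free-tail es free′)) (open-tail j i es free i′ open′)

  module _ (i : Fin n) {Accept : Fin m → Set} (accept? : Decidable Accept) where

    takeable? : ∀ es → Decidable (λ j → Free j es × Open es i × Accept j)
    takeable? es j = free? es j ×-dec open? es i ×-dec accept? j

    -- The new decisions are kept apart from the old ones because they have to be put into the
    -- message. One pass over the colors suffices, as what is refused once stays refused
    -- (`grab-rejects`).
    grab : List (Fin m) → List (Entry n m) → List (Entry n m) → List (Entry n m)
    grab []       new old = new
    grab (j ∷ js) new old with takeable? (new ++ old) j
    ... | yes _ = grab js ((j , i) ∷ new) old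
    ... | no _  = grab js new old

    newEntries : List (Entry n m) → List (Entry n m)
    newEntries = grab (List.allFin m) []

    grab-owner : ∀ js {new} old → All (λ e → proj₂ e ≡ i) new →
                 All (λ e → proj₂ e ≡ i) (grab js new old)
    grab-owner []       old all = all
    grab-owner (j ∷ js) {new} old all with takeable? (new ++ old) j
    ... | yes _ = grab-owner js old (refl ∷ all)
    ... | no _  = grab-owner js old all

    grab-complete : ∀ js {new} old → Complete (new ++ old) → grab js new old ≡ new
    grab-complete []       old complete = refl
    grab-complete (j ∷ js) {new} old complete with takeable? (new ++ old) j
    ... | yes (free , _) with () ← trans (sym free) (proj₂ (complete j))
    ... | no _           = grab-complete js old complete

    -- `P` bounds the available values from above and `Accept` the chosen one from below; `near`
    -- says that the two bounds are close enough.
    grab-run : ∀ {Q s} {P : Fin m → Fin n → Set} →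
        (∀ {j′ i′ j} → P j′ i′ → Accept j → s * Q j′ i′ ≤ suc s * Q j i) →
               ∀ js {new} old → NearGreedy Q s (new ++ old) → Bounded P (new ++ old) →
               NearGreedy Q s (grab js new old ++ old) × Bounded P (grab js new old ++ old)
    grab-run near []       old run bounded = run , bounded
    grab-run near (j ∷ js) {new} old run bounded with takeable? (new ++ old) j
    ... | yes (free , open-i , accept) = grab-run near js old
          (add run free open-i λ j′ i′ free′ open′ → near (bounded j′ i′ free′ open′) accept)
          (bounded-∷ (new ++ old) free bounded)
    ... | no _ = grab-run near js old run bounded

    grab-monotone : ∀ {P : Fin m → Fin n → Set} js {new} old →
                    Bounded P (new ++ old) → Bounded P (grab js new old ++ old)
    grab-monotone []       old bounded = bounded
    grab-monotone (j ∷ js) {new} old bounded with takeable? (new ++ old) j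
    ... | yes (free , _) = grab-monotone js old (bounded-∷ (new ++ old) free bounded)
    ... | no _           = grab-monotone js old bounded

    grab-rejects : ∀ js {new} old {j} → j ∈ˡ js → Free j (grab js new old ++ old) →
                   Open (grab js new old ++ old) i → ¬ Accept j
    grab-rejects (c ∷ js) {new} old (there j∈js) with takeable? (new ++ old) c
    ... | yes _ = grab-rejects js old j∈js
    ... | no _  = grab-rejects js old j∈js
    grab-rejects (c ∷ js) {new} old (here refl) free open-i accept with takeable? (new ++ old) c
    ... | yes (free-c , _) = grab-monotone {λ j′ _ → j′ ≢ c} js old
            (λ j′ i′ free′ _ → proj₁ (free-tail (new ++ old) free′)) c i free open-i refl
    ... | no ¬takeable = grab-monotone {λ j′ i′ → j′ ≡ c → i′ ≡ i → ⊥} js old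
            (λ { j′ i′ free′ open′ refl refl → ¬takeable (free′ , open′ , accept) }) c i free open-i refl refl

-- Encoding of messages

bit : Bool → ℕ
bit b = if b then 1 else 0

toBits : ℕ → ℕ → List Bool
toBits zero    x = []
toBits (suc b) x = (x % 2 ≡ᵇ 1) ∷ toBits b (x / 2)

fromBits : List Bool → ℕ
fromBits []       = 0
fromBits (c ∷ cs) = bit c + fromBits cs * 2

length-toBits : ∀ b x → length (toBits b x) ≡ b
length-toBits zero    x = refl
length-toBits (suc b) x = cong suc (length-toBits b (x / 2))

fromBits-toBits : ∀ b {x} → x < 2 ^ b → fromBits (toBits b x) ≡ x
fromBits-toBits zero    {zero} _ = refl
fromBits-toBits zero    {suc x} (s≤s ())
fromBits-toBits (suc b) {x} x<2^1+b = begin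
  bit (x % 2 ≡ᵇ 1) + fromBits (toBits b (x / 2)) * 2
    ≡⟨ cong₂ (λ u v → u + v * 2) (bit-digit (x % 2) (m%n<n x 2))
         (fromBits-toBits b (m<n*o⇒m/o<n (subst (x <_) (*-comm 2 (2 ^ b)) x<2^1+b))) ⟩
  x % 2 + x / 2 * 2
    ≡⟨ m≡m%n+[m/n]*n x 2 ⟨
  x ∎
  where
  open ≡-Reasoning
  bit-digit : ∀ p → p < 2 → bit (p ≡ᵇ 1) ≡ p
  bit-digit 0 _ = refl
  bit-digit 1 _ = refl
  bit-digit (suc (suc p)) (s≤s (s≤s ()))

module Codec (n m b : ℕ) where

  encodeEntry : Entry n m → Message
  encodeEntry (j , i) = toBits b (toℕ (combine j i))

  decodeEntry : Message → List (Entry n m)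
  decodeEntry w with fromBits w ℕ.<? m * n
  ... | yes p = remQuot n (fromℕ< p) ∷ []
  ... | no _  = []

  encode : List (Entry n m) → Message
  encode = concatMap encodeEntry

  -- The fuel makes the recursion structural. The length of the message is enough of it, since every
  -- entry takes at least one bit.
  decode : ℕ → Message → List (Entry n m)
  decode zero       _       = []
  decode (suc fuel) []      = []
  decode (suc fuel) (c ∷ w) = decodeEntry (take b (c ∷ w)) ++ decode fuel (drop b (c ∷ w))

  pack : List (Entry n m) → Maybe Message
  pack []         = nothing
  pack M@(_ ∷ _) = just (encode M)

  unpack : Maybe Message → List (Entry n m)
  unpack nothing  = []
  unpack (just w) = decode (length w) w

  length-encode : ∀ M → length (encode M) ≡ length M * b
  length-encode []      = refl
  length-encode (e ∷ M) = trans (length-++ (encodeEntry e))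
    (cong₂ _+_ (length-toBits b _) (length-encode M))

  module _ (wide : m * n ≤ 2 ^ b) (b>0 : 0 < b) where

    decodeEntry-encodeEntry : ∀ e → decodeEntry (encodeEntry e) ≡ e ∷ []
    decodeEntry-encodeEntry (j , i) with fromBits (toBits b (toℕ (combine j i))) ℕ.<? m * n
    ... | no ≮  = contradiction (subst (_< m * n) (sym code) (toℕ<n (combine j i))) ≮
      where
      code : fromBits (toBits b (toℕ (combine j i))) ≡ toℕ (combine j i)
      code = fromBits-toBits b (<-≤-trans (toℕ<n (combine j i)) wide)
    ... | yes p = cong (_∷ []) (trans (cong (remQuot n) (from p code)) (remQuot-combine j i))
      where
      code : fromBits (toBits b (toℕ (combine j i))) ≡ toℕ (combine j i)
      code = fromBits-toBits b (<-≤-trans (toℕ<n (combine j i)) wide)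
      from : ∀ {x} (p : x < m * n) {f : Fin (m * n)} → x ≡ toℕ f → fromℕ< p ≡ f
      from p {f} refl = fromℕ<-toℕ f p

    decode-++ : ∀ w {v : Message} → length w ≡ b → ∀ fuel →
        decode (suc fuel) (w ++ v) ≡ decodeEntry w ++ decode fuel v
    decode-++ []      refl fuel = contradiction b>0 (<-irrefl refl)
    decode-++ (c ∷ w) {v} len fuel =
      cong₂ (λ x y → decodeEntry x ++ decode fuel y) (take-exact (c ∷ w) len) (drop-exact (c ∷ w) len)
      where
      take-exact : ∀ (u : Message) {k} → length u ≡ k → take k (u ++ v) ≡ u
      take-exact []      refl = refl
      take-exact (x ∷ u) refl = cong (x ∷_) (take-exact u refl)
      drop-exact : ∀ (u : Message) {k} → length u ≡ k → drop k (u ++ v) ≡ v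
      drop-exact []      refl = refl
      drop-exact (x ∷ u) refl = drop-exact u refl

    decode-encode : ∀ M fuel → length M ≤ fuel → decode fuel (encode M) ≡ M
    decode-encode []      zero       _       = refl
    decode-encode []      (suc fuel) _       = refl
    decode-encode (e ∷ M) (suc fuel) (s≤s p) = trans
      (decode-++ (encodeEntry e) (length-toBits b _) fuel)
      (cong₂ _++_ (decodeEntry-encodeEntry e) (decode-encode M fuel p))

    unpack-pack : ∀ M → unpack (pack M) ≡ M
    unpack-pack []         = refl
    unpack-pack M@(_ ∷ _) = decode-encode M (length (encode M))
      (subst (length M ≤_) (sym (length-encode M)) (m≤m*n (length M) b {{>-nonZero b>0}}))

messageCost : ℕ → Maybe Message → ℕ
messageCost n = maybe (basicMessages n) 0

basicMessages-empty : ∀ n → basicMessages n [] ≡ 1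
basicMessages-empty n = m≥n⇒m⊔n≡m (≤-trans (≤-reflexive (m<n⇒m/n≡0 (n<1+n ⌊log₂ n ⌋))) z≤n)

-- An entry fills exactly `d` basic messages, so rounding loses nothing. The charge is an equality,
-- from which the upper and the lower bound on the messages are both read off.
pack-cost : ∀ n m d .{{_ : NonZero d}} M →
            messageCost n (Codec.pack n m (d * suc ⌊log₂ n ⌋) M) ≡ d * length M
pack-cost n m d []         = sym (*-zeroʳ d)
pack-cost n m d M@(_ ∷ _) = begin
  1 ⊔ ((length (Codec.encode n m (d * l) M) + ⌊log₂ n ⌋) / l)
    ≡⟨ cong (λ u → 1 ⊔ ((u + ⌊log₂ n ⌋) / l)) (trans (Codec.length-encode n m (d * l) M) (assoc (length M) d l)) ⟩
  1 ⊔ ((d * length M * l + ⌊log₂ n ⌋) / l)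
    ≡⟨ cong (1 ⊔_) quotient ⟩
  1 ⊔ (d * length M)
    ≡⟨ m≤n⇒m⊔n≡n (>-nonZero⁻¹ (d * length M) {{m*n≢0 d (length M)}}) ⟩
  d * length M ∎
  where
  open ≡-Reasoning
  l = suc ⌊log₂ n ⌋
  assoc : ∀ x d l → x * (d * l) ≡ d * x * l
  assoc = solve-∀
  quotient : (d * length M * l + ⌊log₂ n ⌋) / l ≡ d * length M
  quotient = begin
    (d * length M * l + ⌊log₂ n ⌋) / l       ≡⟨ +-distrib-/ (d * length M * l) ⌊log₂ n ⌋
         (subst (λ u → u + ⌊log₂ n ⌋ % l < l) (sym (m*n%n≡0 (d * length M) l)) (m%n<n ⌊log₂ n ⌋ l)) ⟩
    d * length M * l / l + ⌊log₂ n ⌋ / l     ≡⟨ cong₂ _+_ (m*n/n≡m (d * length M) l) (m<n⇒m/n≡0 (n<1+n ⌊log₂ n ⌋)) ⟩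
    d * length M + 0                         ≡⟨ +-identityʳ _ ⟩
    d * length M                             ∎

n<2^[1+⌊log₂n⌋] : ∀ n → n < 2 ^ suc ⌊log₂ n ⌋
n<2^[1+⌊log₂n⌋] n = ≰⇒> λ p → <-irrefl refl
  (≤-trans (≤-reflexive (sym (⌊log₂[2^n]⌋≡n (suc ⌊log₂ n ⌋)))) (⌊log₂⌋-mono-≤ p))

n≤2^n : ∀ n → n ≤ 2 ^ n
n≤2^n zero    = z≤n
n≤2^n (suc n) = ≤-trans (+-mono-≤ (m^n>0 2 n) (n≤2^n n)) (≤-reflexive (cong (2 ^ n +_) (sym (+-identityʳ (2 ^ n)))))

-- With l = suc ⌊log₂ n ⌋ one has n < 2 ^ l, so that K, n ^ c and n fit into K * l, c * l and l
-- bits. This is the origin of the suc (K + c) basic messages per decision and hop.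
wide-enough : ∀ c K n m → m ≤ K * n ^ c → m * n ≤ 2 ^ (suc (K + c) * suc ⌊log₂ n ⌋)
wide-enough c K n m m≤ = begin
  m * n                             ≤⟨ *-monoˡ-≤ n m≤ ⟩
  K * n ^ c * n                     ≤⟨ *-mono-≤ (*-mono-≤ K≤ (^-monoˡ-≤ c n≤)) n≤ ⟩
  2 ^ (K * l) * (2 ^ l) ^ c * 2 ^ l ≡⟨ cong (λ u → 2 ^ (K * l) * u * 2 ^ l) (^-*-assoc 2 l c) ⟩
  2 ^ (K * l) * 2 ^ (l * c) * 2 ^ l ≡⟨ cong (_* 2 ^ l) (^-distribˡ-+-* 2 (K * l) (l * c)) ⟨
  2 ^ (K * l + l * c) * 2 ^ l       ≡⟨ ^-distribˡ-+-* 2 (K * l + l * c) l ⟨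
  2 ^ (K * l + l * c + l)           ≡⟨ cong (2 ^_) (lemma K c l) ⟩
  2 ^ (suc (K + c) * l)             ∎
  where
  open ≤-Reasoning
  l = suc ⌊log₂ n ⌋
  n≤ : n ≤ 2 ^ l
  n≤ = <⇒≤ (n<2^[1+⌊log₂n⌋] n)
  K≤ : K ≤ 2 ^ (K * l)
  K≤ = ≤-trans (n≤2^n K) (^-monoʳ-≤ 2 (m≤m*n K l))
  lemma : ∀ K c l → K * l + l * c + l ≡ suc (K + c) * l
  lemma = solve-∀

-- Geometric thresholds

module Threshold (s : ℕ) .{{_ : NonZero s}} where

  -- x < (1 + 1/s) ^ k
  Below : ℕ → ℕ → Set
  Below k x = x * s ^ k < suc s ^ k

  below? : ∀ k → Decidable (Below k)
  below? k x = x * s ^ k ℕ.<? suc s ^ k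

  below-suc : ∀ k x → Below k x → Below (suc k) x
  below-suc k x p = begin-strict
    x * (s * s ^ k)   ≡⟨ lemma x s (s ^ k) ⟩
    s * (x * s ^ k)   ≤⟨ *-monoˡ-≤ (x * s ^ k) (n≤1+n s) ⟩
    suc s * (x * s ^ k) <⟨ *-monoʳ-< (suc s) p ⟩
    suc s * suc s ^ k ∎
    where
    open ≤-Reasoning
    lemma : ∀ x s p → x * (s * p) ≡ s * (x * p)
    lemma = solve-∀

  below-≤ : ∀ k {x y} → x ≤ y → Below k y → Below k x
  below-≤ k x≤y = ≤-<-trans (*-monoˡ-≤ (s ^ k) x≤y)

  -- Consecutive thresholds differ by the factor 1 + 1/s, which becomes the factor in `NearGreedy`.
  below-near : ∀ k x y → Below (suc k) x → ¬ Below k y → s * x ≤ suc s * y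
  below-near k x y x<θ y≮θ = *-cancelʳ-≤ (s * x) (suc s * y) (s ^ k) {{m^n≢0 s k}} (begin
    s * x * s ^ k       ≡⟨ lemma x s (s ^ k) ⟩
    x * (s * s ^ k)     ≤⟨ <⇒≤ x<θ ⟩
    suc s * suc s ^ k   ≤⟨ *-monoʳ-≤ (suc s) (≮⇒≥ y≮θ) ⟩
    suc s * (y * s ^ k) ≡⟨ *-assoc (suc s) y (s ^ k) ⟨
    suc s * y * s ^ k   ∎)
    where
    open ≤-Reasoning
    lemma : ∀ x s p → s * x * p ≡ x * (s * p)
    lemma = solve-∀

  bernoulli : ∀ k → (s + k) * s ^ k ≤ s * suc s ^ k
  bernoulli zero    = ≤-reflexive (cong (_* 1) (+-identityʳ s))
  bernoulli (suc k) = begin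
    (s + suc k) * (s * s ^ k)                 ≤⟨ m≤m+n _ (k * s ^ k) ⟩
    (s + suc k) * (s * s ^ k) + k * s ^ k     ≡⟨ lemma s k (s ^ k) ⟩
    suc s * ((s + k) * s ^ k)                 ≤⟨ *-monoʳ-≤ (suc s) (bernoulli k) ⟩
    suc s * (s * suc s ^ k)                   ≡⟨ swap (suc s) s (suc s ^ k) ⟩
    s * (suc s * suc s ^ k)                   ∎
    where
    open ≤-Reasoning
    lemma : ∀ s k p → (s + suc k) * (s * p) + k * p ≡ suc s * ((s + k) * p)
    lemma = solve-∀
    swap : ∀ x s p → x * (s * p) ≡ s * (x * p)
    swap = solve-∀

  -- Bernoulli's inequality with exponent s * x gives at least 1 + x. An exponent linear in x is
  -- crude, but it is only the fuel of `climb`; the time bound rests on `Early`.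
  below-large : ∀ x → Below (s * x) x
  below-large x = *-cancelˡ-< s _ _ (begin-strict
    s * (x * s ^ k)   ≡⟨ *-assoc s x (s ^ k) ⟨
    k * s ^ k         <⟨ *-monoˡ-< (s ^ k) {{m^n≢0 s k}} (m<n+m k (>-nonZero⁻¹ s)) ⟩
    (s + k) * s ^ k   ≤⟨ bernoulli k ⟩
    s * suc s ^ k     ∎)
    where
    open ≤-Reasoning
    k = s * x

-- The protocol

data Mode (n m : ℕ) : Set where
  waiting : (held : Bool) → Mode n m
  passed  : Mode n m
  -- The arguments are the number of turns left and the decisions known.
  running : ℕ → List (Entry n m) → Mode n m

module Protocol (s : ℕ) .{{_ : NonZero s}} (d n m : ℕ) .{{_ : NonZero n}} where

  open Threshold s public
  open Codec n m (d * suc ⌊log₂ n ⌋) public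

  -- An upper bound on the items in play when R turns are left; the last turn only serves to
  -- complete the circulation of the decisions.
  Cap : ℕ → ℕ → Set
  Cap 0             x = ⊥
  Cap 1             x = ⊥
  Cap (suc (suc k)) x = Below k x

  cap? : ∀ R → Decidable (Cap R)
  cap? 0             x = no id
  cap? 1             x = no id
  cap? (suc (suc k)) x = below? k x

  Ready : ℕ → (Fin m → ℕ) → Set
  Ready ρ q = ∀ j → Below ρ (q j)

  ready? : ∀ ρ q → Dec (Ready ρ q)
  ready? ρ q = all? (below? ρ ∘ q)

  foreign : Fin n → List (Entry n m) → List (Entry n m)
  foreign i = filter (λ e → ¬? (proj₂ e ≟ i))

  chosen : Fin n → (Fin m → ℕ) → ℕ → List (Entry n m) → List (Entry n m)
  chosen i q R = newEntries i (λ j → ¬? (cap? R (q j)))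

  pass : ℕ → (Fin m → ℕ) → Mode n m × Maybe Message
  pass ρ q with ready? ρ q
  ... | yes _ = passed , just []
  ... | no _  = waiting true , nothing

  -- An agent in `passed` gets the empty message again only after everybody has passed it on. All
  -- agents get it in the same rotation ρ, so they enter `running` with the same number of turns
  -- left.
  turn : Fin n → (Fin m → ℕ) → ℕ → Maybe Message → Mode n m → Mode n m × Maybe Message
  turn i q ρ msg      (waiting true)            = pass ρ q
  turn i q ρ (just _) (waiting false)           = pass ρ q
  turn i q ρ nothing  (waiting false)           = waiting false , nothing
  turn i q ρ (just _) passed                    = running (suc ρ) [] , just []
  turn i q ρ nothing  passed                    = passed , nothing
  turn i q ρ msg      (running zero known)      = running zero known , nothing
  turn i q ρ msg      (running (suc R) known)   =
    running R (new ++ kept ++ known) , pack (new ++ kept)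
    where
    kept = foreign i (unpack msg)
    new  = chosen i q R (kept ++ known)

  colorsOf : Fin n → Mode n m → Maybe (Subset m)
  colorsOf i (running zero known) = just (Vec.tabulate λ j → does (owned? known i j))
  colorsOf i _                    = nothing

  agent : Fin n → Program m
  agent i = record
    { State  = (Fin m → ℕ) × Mode n m
    ; start  = λ q → q , (if does (toℕ i ℕ.≟ 0) then waiting true else waiting false)
    ; step   = step
    ; output = λ (_ , mode) → colorsOf i mode
    }
    where
    step : ℕ → (Side → Maybe Message) → (Fin m → ℕ) × Mode n m → ((Fin m → ℕ) × Mode n m) × Outgoing
    step t inbox (q , mode) with t % n ℕ.≟ toℕ i
    ... | no _  = (q , mode) , nothing
    ... | yes _ = (q , proj₁ (turn i q (t / n) (inbox prev) mode)) ,
                  Maybe.map (next ,_) (proj₂ (turn i q (t / n) (inbox prev) mode))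

algorithm : (s : ℕ) .{{_ : NonZero s}} → ℕ → Algorithm
algorithm s d (suc n) m i = Protocol.agent s d (suc n) m i

-- Execution of the protocol

module Rounds (s : ℕ) .{{_ : NonZero s}} (d n′ m : ℕ) (Q : Items (suc n′) m) where

  n : ℕ
  n = suc n′

  open Protocol s d n m public
  open Execution (algorithm s d) Q hiding (messages; Halted; Computes)

  sentMessages : ℕ → ℕ
  sentMessages = messages (algorithm s d) Q

  column : Fin n → Fin m → ℕ
  column i j = Q j i

  mode : ℕ → Fin n → Mode n m
  mode t i = proj₂ (state (after t) i)

  incoming : ℕ → Maybe Message
  incoming t = inbox (after t) (t mod n) prev

  activate-idle : ∀ t C i → t % n ≢ toℕ i → activate t C i ≡ (state C i , nothing)
  activate-idle t C i idle with colorsOf i (proj₂ (state C i))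
  ... | just _  = refl
  ... | nothing with t % n ℕ.≟ toℕ i
  ...   | yes p = contradiction p idle
  ...   | no _  = refl

  activate-turn : ∀ t C i → t % n ≡ toℕ i → colorsOf i (proj₂ (state C i)) ≡ nothing →
    let (q , md) = state C i
        (md′ , out) = turn i q (t / n) (inbox C i prev) md
    in activate t C i ≡ ((q , md′) , Maybe.map (next ,_) out)
  activate-turn t C i active unhalted with colorsOf i (proj₂ (state C i))
  activate-turn t C i active () | just _
  activate-turn t C i active unhalted | nothing with t % n ℕ.≟ toℕ i
  ... | yes _ = refl
  ... | no ¬p = contradiction active ¬p

  keeps-column : ∀ t i → proj₁ (state (after t) i) ≡ column i
  keeps-column zero    i = refl
  keeps-column (suc t) i = trans (step-column (t % n ℕ.≟ toℕ i)) (keeps-column t i)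
    where
    step-column : Dec (t % n ≡ toℕ i) → proj₁ (state (after (suc t)) i) ≡ proj₁ (state (after t) i)
    step-column (no idle) = cong (proj₁ ∘ proj₁) (activate-idle t (after t) i idle)
    step-column (yes active) with colorsOf i (mode t i) in eq
    ... | just _  = refl
    ... | nothing with t % n ℕ.≟ toℕ i
    ...   | yes _ = refl
    ...   | no _  = refl

  toℕ-mod : ∀ t → toℕ (t mod n) ≡ t % n
  toℕ-mod t = toℕ-fromℕ< (m%n<n t n)

  prev-next : ∀ t → neighbour {n} prev (suc t mod n) ≡ t mod n
  prev-next t = toℕ-injective (begin
    toℕ (neighbour {n} prev (suc t mod n))  ≡⟨ toℕ-mod (toℕ (suc t mod n) + n′) ⟩
    (toℕ (suc t mod n) + n′) % n            ≡⟨ cong (λ u → (u + n′) % n) (toℕ-mod (suc t)) ⟩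
    (suc t % n + n′) % n                    ≡⟨ %-distribˡ-+ (suc t % n) n′ n ⟩
    (suc t % n % n + n′ % n) % n            ≡⟨ cong (λ u → (u + n′ % n) % n) (m%n%n≡m%n (suc t) n) ⟩
    (suc t % n + n′ % n) % n                ≡⟨ %-distribˡ-+ (suc t) n′ n ⟨
    (suc t + n′) % n                        ≡⟨ cong (_% n) (+-suc t n′) ⟨
    (t + n) % n                             ≡⟨ [m+n]%n≡m%n t n ⟩
    t % n                                   ≡⟨ toℕ-mod t ⟨
    toℕ (t mod n)                           ∎)
    where open ≡-Reasoning

  receive-prev : ∀ out → receive prev (Maybe.map (next ,_) out) ≡ out
  receive-prev nothing  = refl
  receive-prev (just _) = refl

  -- One agent acts per round, and what it sends is read by the agent acting in the next round. The
  -- execution is thereby reduced to a single message walking along the ring.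
  record Advance (t : ℕ) (i : Fin n) (md : Mode n m) (out : Maybe Message) : Set where
    field
      mode-active : mode (suc t) i ≡ md
      mode-idle   : ∀ y → y ≢ i → mode (suc t) y ≡ mode t y
      incoming≡   : incoming (suc t) ≡ out
      messages≡   : sentMessages (suc t) ≡ sentMessages t + messageCost n out

  advance : ∀ t i → t % n ≡ toℕ i → colorsOf i (mode t i) ≡ nothing →
            let (md , out) = turn i (column i) (t / n) (incoming t) (mode t i) in Advance t i md out
  advance t i active unhalted = subst
    (λ x → colorsOf x (mode t x) ≡ nothing →
        let (md , out) = turn x (column x) (t / n) (incoming t) (mode t x) in Advance t x md out)
    (toℕ-injective (trans (toℕ-mod t) active)) advance-mod unhalted
    where
    x = t mod n
    advance-mod : colorsOf x (mode t x) ≡ nothing →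
      let (md , out) = turn x (column x) (t / n) (incoming t) (mode t x) in Advance t x md out
    advance-mod unhalted = record
      { mode-active = cong (proj₂ ∘ proj₁) acts
      ; mode-idle   = λ y y≢x → cong (proj₂ ∘ proj₁) (rests y y≢x)
      ; incoming≡   = trans (cong (λ y → receive prev (sent (after (suc t)) y)) (prev-next t))
                        (trans (cong (receive prev) (cong proj₂ acts)) (receive-prev _))
      ; messages≡   = cong (sentMessages t +_) (trans
          (sum-single (λ y → charge (sent (after (suc t)) y)) x λ y y≢x → cong charge (cong proj₂ (rests y y≢x)))
          (trans (cong charge (cong proj₂ acts))
              (charge-next (proj₂ (turn x (column x) (t / n) (incoming t) (mode t x))))))
      }
      where
      charge : Outgoing → ℕ
      charge = maybe (λ { (_ , b) → basicMessages n b }) 0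
      charge-next : ∀ out → charge (Maybe.map (next ,_) out) ≡ messageCost n out
      charge-next nothing  = refl
      charge-next (just _) = refl
      rests : ∀ y → y ≢ x → activate t (after t) y ≡ (state (after t) y , nothing)
      rests y y≢x = activate-idle t (after t) y λ p → y≢x (toℕ-injective (trans (sym p) (sym (toℕ-mod t))))
      acts : activate t (after t) x ≡
             ((proj₁ (state (after t) x) , proj₁ (turn x (column x) (t / n) (incoming t) (mode t x))) ,
              Maybe.map (next ,_) (proj₂ (turn x (column x) (t / n) (incoming t) (mode t x))))
      acts = trans (activate-turn t (after t) x (sym (toℕ-mod t)) unhalted)
        (cong (λ q → ((proj₁ (state (after t) x) , proj₁ (turn x q (t / n) (incoming t) (mode t x))) ,
              Maybe.map (next ,_) (proj₂ (turn x q (t / n) (incoming t) (mode t x))))) (keeps-column t x))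

  -- Round i of rotation ρ.
  time : ℕ → ℕ → ℕ
  time ρ i = i + ρ * n

  time%n : ∀ ρ i → i < n → time ρ i % n ≡ i
  time%n ρ i i<n = trans ([m+kn]%n≡m%n i ρ n) (m<n⇒m%n≡m i<n)

  time/n : ∀ ρ i → i < n → time ρ i / n ≡ ρ
  time/n ρ i i<n = begin
    (i + ρ * n) / n     ≡⟨ +-distrib-/-∣ʳ i (n∣m*n ρ) ⟩
    i / n + ρ * n / n   ≡⟨ cong₂ _+_ (m<n⇒m/n≡0 i<n) (m*n/n≡m ρ n) ⟩
    ρ                   ∎
    where open ≡-Reasoning

  advance-in : ∀ ρ x → let t = time ρ (toℕ x) in colorsOf x (mode t x) ≡ nothing →
               let (md , out) = turn x (column x) ρ (incoming t) (mode t x) in Advance t x md out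
  advance-in ρ x unhalted = subst
    (λ k → let (md , out) = turn x (column x) k (incoming t) (mode t x) in Advance t x md out)
    (time/n ρ (toℕ x) (toℕ<n x)) (advance t x (time%n ρ (toℕ x) (toℕ<n x)) unhalted)
    where t = time ρ (toℕ x)

  over-rotation : (P : ℕ → Set) → (∀ (x : Fin n) → P (toℕ x) → P (suc (toℕ x))) → P 0 → P n
  over-rotation P step P0 = go n ≤-refl
    where
    go : ∀ i → i ≤ n → P i
    go zero    _   = P0
    go (suc i) i<n = subst (P ∘ suc) (toℕ-fromℕ< i<n)
      (step (fromℕ< i<n) (subst P (sym (toℕ-fromℕ< i<n)) (go i (<⇒≤ i<n))))

-- The two tours of the empty message

module Climbing (s : ℕ) .{{_ : NonZero s}} (d n′ m : ℕ) (Q : Items (suc n′) m) where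

  open Rounds s d n′ m Q public

  p : ℕ
  p = maxItems Q

  Q≤p : ∀ j i → Q j i ≤ p
  Q≤p j i = ≤-trans (term≤max (Q j) i) (term≤max (λ j → Vector.foldr _⊔_ 0 (Q j)) j)
    where
    term≤max : ∀ {k} (f : Fin k → ℕ) i → f i ≤ Vector.foldr _⊔_ 0 f
    term≤max f zero    = m≤m⊔n _ _
    term≤max f (suc i) = ≤-trans (term≤max (f ∘ suc) i) (m≤n⊔m (f zero) _)

  -- The empty message has been passed on by the agents before h.
  record Climb (ρ i h : ℕ) : Set where
    field
      done     : ∀ y → toℕ y < h → mode (time ρ i) y ≡ passed × Ready ρ (column y)
      todo     : ∀ y → h < toℕ y → mode (time ρ i) y ≡ waiting false
      -- Either agent `h` holds the message, or it was sent in the preceding round and reaches `h`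
      -- right now. Only the second case allows h = n, the completed tour.
      token    : ((∀ y → toℕ y ≡ h → mode (time ρ i) y ≡ waiting true) ×
                   incoming (time ρ i) ≡ nothing × h < n) ⊎
                 ((∀ y → toℕ y ≡ h → mode (time ρ i) y ≡ waiting false) ×
                   incoming (time ρ i) ≡ just [] × i ≡ h)
      -- Agent `h` has had its turn in this rotation without passing the message on, so one of its
      -- values reaches the threshold.
      stuck    : h < i → ¬ Below ρ p
      charged  : sentMessages (time ρ i) ≡ h

  ready-suc : ∀ ρ y → Ready ρ (column y) → Ready (suc ρ) (column y)
  ready-suc ρ y ready j = below-suc ρ (Q j y) (ready j)

  climb-start : Climb 0 0 0
  climb-start = record
    { done    = λ _ ()
    ; todo    = λ { (suc y) _ → refl }
    ; token   = inj₁ ((λ { zero _ → refl }) , refl , s≤s z≤n)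
    ; stuck   = λ ()
    ; charged = refl
    }

  climb-next : ∀ {ρ h} → h < n → Climb ρ n h → Climb (suc ρ) 0 h
  climb-next {ρ} {h} h<n c = record
    { done    = λ y y<h → proj₁ (done y y<h) , ready-suc ρ y (proj₂ (done y y<h))
    ; todo    = todo
    ; token   = [ inj₁ , (λ (_ , _ , n≡h) → contradiction (sym n≡h) (<⇒≢ h<n)) ]′ token
    ; stuck   = λ ()
    ; charged = charged
    }
    where open Climb c

  climb-turn : ∀ ρ (x : Fin n) → (∃ λ h → Climb ρ (toℕ x) h) → ∃ λ h → Climb ρ (suc (toℕ x)) h
  climb-turn ρ x (h , c) = by-position (<-cmp i h)
    where
    open Climb c
    i = toℕ x
    t = time ρ i

    rest : ∀ {md} → mode t x ≡ md → colorsOf x md ≡ nothing → incoming t ≡ nothing →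
           turn x (column x) ρ nothing md ≡ (md , nothing) → i ≢ h → h < n →
           Climb ρ (suc i) h
    rest {md} mode≡ unhalted silent idle i≢h h<n = record
      { done    = λ y y<h → trans (same y) (proj₁ (done y y<h)) , proj₂ (done y y<h)
      ; todo    = λ y h<y → trans (same y) (todo y h<y)
      ; token   = inj₁ (holder , trans incoming≡ (cong proj₂ turn≡) , h<n)
      ; stuck   = λ h<1+i → stuck (≤∧≢⇒< (s≤s⁻¹ h<1+i) (≢-sym i≢h))
      ; charged = trans messages≡ (trans (cong (λ o → sentMessages t + messageCost n o) (cong proj₂ turn≡))
                    (trans (+-identityʳ _) charged))
      }
      where
      open Advance (advance-in ρ x (trans (cong (colorsOf x) mode≡) unhalted))
      turn≡ : turn x (column x) ρ (incoming t) (mode t x) ≡ (md , nothing)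
      turn≡ = trans (cong₂ (turn x (column x) ρ) silent mode≡) idle
      same : ∀ y → mode (suc t) y ≡ mode t y
      same y with y ≟ x
      ... | yes refl = trans mode-active (trans (cong proj₁ turn≡) (sym mode≡))
      ... | no y≢x   = mode-idle y y≢x
      holder : ∀ y → toℕ y ≡ h → mode (suc t) y ≡ waiting true
      holder y y≡h = trans (same y) ([ (λ (held , _) → held y y≡h)
        , (λ (_ , msg , _) → contradiction (trans (sym msg) silent) λ ()) ]′ token)

    try : colorsOf x (mode t x) ≡ nothing → turn x (column x) ρ (incoming t) (mode t x) ≡ pass ρ (column x) →
          i ≡ h → ∃ λ h → Climb ρ (suc i) h
    try unhalted turn≡ i≡h with ready? ρ (column x)
    ... | yes ready = suc h , record
      { done    = λ y y≤h → done′ y (m≤n⇒m<n∨m≡n (s≤s⁻¹ y≤h))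
      ; todo    = λ y h<y → trans (mode-idle y (λ { refl → <⇒≢ (<-trans (n<1+n h) h<y) (sym i≡h) }))
                    (todo y (<-trans (n<1+n h) h<y))
      ; token   = inj₂ ((λ y y≡1+h → trans (mode-idle y (λ { refl → 1+n≢n (trans (sym y≡1+h) i≡h) }))
                           (todo y (≤-reflexive (sym y≡1+h))))
                    , trans incoming≡ (cong proj₂ turn≡) , cong suc i≡h)
      ; stuck   = λ 1+h<1+i → contradiction (s≤s⁻¹ 1+h<1+i) (<-irrefl (sym i≡h))
      ; charged = trans messages≡ (trans (cong₂ (λ u o → u + messageCost n o) charged (cong proj₂ turn≡))
                    (trans (cong (h +_) (basicMessages-empty n)) (+-comm h 1)))
      }
      where
      open Advance (advance-in ρ x unhalted)
      done′ : ∀ y → toℕ y < h ⊎ toℕ y ≡ h → mode (suc t) y ≡ passed × Ready ρ (column y)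
      done′ y (inj₁ y<h) = trans (mode-idle y (λ { refl → <⇒≢ y<h i≡h })) (proj₁ (done y y<h)) , proj₂ (done y y<h)
      done′ y (inj₂ y≡h) with toℕ-injective (trans y≡h (sym i≡h))
      ... | refl = trans mode-active (cong proj₁ turn≡) , ready
    ... | no ¬ready = h , record
      { done    = λ y y<h → trans (mode-idle y (λ { refl → <⇒≢ y<h i≡h })) (proj₁ (done y y<h)) , proj₂ (done y y<h)
      ; todo    = λ y h<y → trans (mode-idle y (λ { refl → <⇒≢ h<y (sym i≡h) })) (todo y h<y)
      ; token   = inj₁ ((λ y y≡h → subst (λ y → mode (suc t) y ≡ waiting true)
                           (toℕ-injective (trans i≡h (sym y≡h))) (trans mode-active (cong proj₁ turn≡)))
                    , trans incoming≡ (cong proj₂ turn≡) , subst (_< n) i≡h (toℕ<n x))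
      ; stuck   = λ _ below → ¬ready λ j → below-≤ ρ (Q≤p j x) below
      ; charged = trans messages≡ (trans (cong₂ (λ u o → u + messageCost n o) charged (cong proj₂ turn≡))
                    (+-identityʳ h))
      }
      where open Advance (advance-in ρ x unhalted)

    by-position : Tri (i < h) (i ≡ h) (h < i) → ∃ λ h → Climb ρ (suc i) h
    by-position (tri< i<h _ _) with token
    ... | inj₂ (_ , _ , i≡h) = contradiction i≡h (<⇒≢ i<h)
    ... | inj₁ (_ , silent , h<n) = h , rest (proj₁ (done x i<h)) refl silent refl (<⇒≢ i<h) h<n
    by-position (tri≈ _ i≡h _) with token
    ... | inj₁ (held , silent , _) = try (cong (colorsOf x) (held x i≡h))
            (cong₂ (turn x (column x) ρ) silent (held x i≡h)) i≡h
    ... | inj₂ (free , msg , _)    = try (cong (colorsOf x) (free x i≡h))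
            (cong₂ (turn x (column x) ρ) msg (free x i≡h)) i≡h
    by-position (tri> _ _ h<i) with token
    ... | inj₂ (_ , _ , i≡h) = contradiction (sym i≡h) (<⇒≢ h<i)
    ... | inj₁ (_ , silent , h<n) = h , rest (todo x h<i) refl silent refl (≢-sym (<⇒≢ h<i)) h<n

  -- The tour was not completed in the rotation before ρ, so (1 + 1/s) ^ (ρ - 1) ≤ p. This bounds
  -- the number of rotations by a logarithm of p.
  Early : ℕ → Set
  Early ρ = ∀ k → ρ ≡ suc k → ¬ Below k p

  climb : ∀ fuel ρ → Below (fuel + ρ) p → Early ρ → (∃ λ h → Climb ρ 0 h) →
          ∃ λ ρ → Early ρ × Climb ρ n n
  climb fuel ρ below early start with over-rotation (λ i → ∃ λ h → Climb ρ i h) (climb-turn ρ) start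
  ... | h , c with Climb.token c
  ...   | inj₂ (_ , _ , refl) = ρ , early , c
  ...   | inj₁ (_ , _ , h<n)  with fuel
  -- Without fuel the threshold exceeds all items, and no agent can hold the message back.
  ...     | zero     = contradiction below (Climb.stuck c h<n)
  ...     | suc fuel = climb fuel (suc ρ) (subst (λ k → Below k p) (sym (+-suc fuel ρ)) below)
              (λ { k refl → Climb.stuck c h<n }) (h , climb-next h<n c)

  climbed : ∃ λ ρ → Early ρ × Climb ρ n n
  climbed = climb (s * p) 0 (subst (λ k → Below k p) (sym (+-identityʳ (s * p))) (below-large p))
    (λ _ ()) (0 , climb-start)

  record Launch (ρ i : ℕ) : Set where
    field
      launched : ∀ y → toℕ y < i → mode (time ρ i) y ≡ running (suc ρ) []
      ready    : ∀ y → i ≤ toℕ y → mode (time ρ i) y ≡ passed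
      signal   : incoming (time ρ i) ≡ just []
      charged  : sentMessages (time ρ i) ≡ i + n

  launch-turn : ∀ ρ (x : Fin n) → Launch ρ (toℕ x) → Launch ρ (suc (toℕ x))
  launch-turn ρ x l = record
    { launched = λ y y≤i → launched′ y (m≤n⇒m<n∨m≡n (s≤s⁻¹ y≤i))
    ; ready    = λ y i<y → trans (mode-idle y (λ { refl → <-irrefl refl i<y })) (ready y (<⇒≤ i<y))
    ; signal   = trans incoming≡ (cong proj₂ turn≡)
    ; charged  = trans messages≡ (trans (cong₂ (λ u o → u + messageCost n o) charged (cong proj₂ turn≡))
                   (trans (cong (i + n +_) (basicMessages-empty n)) (+-comm (i + n) 1)))
    }
    where
    open Launch l
    i = toℕ x
    t = time ρ i
    mode≡ : mode t x ≡ passed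
    mode≡ = ready x ≤-refl
    turn≡ : turn x (column x) ρ (incoming t) (mode t x) ≡ (running (suc ρ) [] , just [])
    turn≡ = cong₂ (turn x (column x) ρ) signal mode≡
    open Advance (advance-in ρ x (cong (colorsOf x) mode≡))
    launched′ : ∀ y → toℕ y < i ⊎ toℕ y ≡ i → mode (suc t) y ≡ running (suc ρ) []
    launched′ y (inj₁ y<i) = trans (mode-idle y (λ { refl → <-irrefl refl y<i })) (launched y y<i)
    launched′ y (inj₂ y≡i) with toℕ-injective y≡i
    ... | refl = trans mode-active (cong proj₁ turn≡)

  launch : ∀ {ρ} → Climb ρ n n → Launch (suc ρ) n
  launch {ρ} c = over-rotation (Launch (suc ρ)) (launch-turn (suc ρ)) (record
    { launched = λ _ ()
    ; ready    = λ y _ → proj₁ (done y (toℕ<n y))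
    ; signal   = [ (λ (_ , _ , n<n) → contradiction n<n (<-irrefl refl)) , proj₁ ∘ proj₂ ]′ token
    ; charged  = charged
    })
    where open Climb c

-- The number of turns from turn i to the next turn of agent o.
delay : ℕ → ℕ → ℕ → ℕ
delay n i o with i ℕ.≤? o
... | yes _ = o ∸ i
... | no _  = n + o ∸ i

delay-≤ : ∀ n {i o} → i ≤ o → delay n i o ≡ o ∸ i
delay-≤ n {i} {o} i≤o with i ℕ.≤? o
... | yes _  = refl
... | no i≰o = contradiction i≤o i≰o

delay-> : ∀ n {i o} → o < i → delay n i o ≡ n + o ∸ i
delay-> n {i} {o} o<i with i ℕ.≤? o
... | yes i≤o = contradiction o<i (≤⇒≯ i≤o)
... | no _    = refl

delay-self : ∀ n i → delay n i i ≡ 0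
delay-self n i = trans (delay-≤ n {i} ≤-refl) (n∸n≡0 i)

delay-step : ∀ n {i o} → i < n → o ≢ i → delay n i o ≡ suc (delay n (suc i) o)
delay-step n {i} {o} i<n o≢i with <-cmp i o
... | tri< i<o _ _ = trans (delay-≤ n (<⇒≤ i<o)) (trans (+-∸-assoc 1 i<o) (cong suc (sym (delay-≤ n i<o))))
... | tri≈ _ i≡o _ = contradiction (sym i≡o) o≢i
... | tri> _ _ o<i = trans (delay-> n o<i) (trans (+-∸-assoc 1 (≤-trans i<n (m≤m+n n o)))
                       (cong suc (sym (delay-> n (<-trans o<i (n<1+n i))))))

delay-reset : ∀ n′ i → delay (suc n′) (suc i) i ≡ n′
delay-reset n′ i = trans (delay-> (suc n′) (n<1+n i)) (m+n∸n≡m n′ i)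

delay-max : ∀ n {i o} → i ≤ n → o < n → delay n i o < n
delay-max n {i} {o} i≤n o<n with i ℕ.≤? o
... | yes _  = ≤-<-trans (m∸n≤m o i) o<n
... | no i≰o = subst (_≤ n) (+-∸-assoc 1 (≤-trans i≤n (m≤m+n n o)))
                (≤-trans (∸-monoʳ-≤ (suc (n + o)) (≰⇒> i≰o)) (≤-reflexive (m+n∸n≡m n o)))

delay-wrap : ∀ n {o} → o < n → delay n n o ≡ delay n 0 o
delay-wrap n {o} o<n = trans (delay-> n o<n) (trans (m+n∸m≡n n o) (sym (delay-≤ n {0} {o} z≤n)))

-- The greedy phase and the circulation of the decisions

module Running (s : ℕ) .{{_ : NonZero s}} (d n′ m : ℕ) .{{_ : NonZero d}} (Q : Items (suc n′) m)
               (wide : m * suc n′ ≤ 2 ^ (d * suc ⌊log₂ suc n′ ⌋)) where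

  open Climbing s d n′ m Q public

  until : ℕ → Fin n → ℕ
  until i y = delay n i (toℕ y)

  owner : Entry n m → Fin n
  owner = proj₂

  -- What agent y has not yet heard of the decisions in the message under way.
  news : ℕ → Fin n → List (Entry n m) → List (Entry n m)
  news i y = filter (λ e → until i y ℕ.<? until i (owner e))

  -- A potential: a decision is forwarded until its owner acts again. Deciding adds n hops and
  -- forwarding removes one, so that `charged` in `Run` is an exact balance.
  hopsLeft : ℕ → List (Entry n m) → ℕ
  hopsLeft i []      = 0
  hopsLeft i (e ∷ M) = until i (owner e) + hopsLeft i M

  -- For R = 1 any value may be chosen, but the available ones lie below (1 + 1/s) ^ 0 = 1, so they
  -- are 0.
  cap-near : ∀ R {x y} → Cap (suc R) x → ¬ Cap R y → s * x ≤ suc s * y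
  cap-near (suc zero)    {zero}  _  _ = ≤-trans (≤-reflexive (*-zeroʳ s)) z≤n
  cap-near (suc zero)    {suc x} (s≤s ()) _
  cap-near (suc (suc k)) {x} {y} p  ¬q = below-near k x y p ¬q

  until-own : ∀ (x : Fin n) → until (toℕ x) x ≡ 0
  until-own x = delay-self n (toℕ x)

  until-other : ∀ (x y : Fin n) → y ≢ x → until (toℕ x) y ≡ suc (until (suc (toℕ x)) y)
  until-other x y y≢x = delay-step n (toℕ<n x) (y≢x ∘ toℕ-injective)

  until-max : ∀ (x y : Fin n) → until (suc (toℕ x)) y ≤ n′
  until-max x y = s≤s⁻¹ (delay-max n (toℕ<n x) (toℕ<n y))

  news-own : ∀ x M → news (toℕ x) x M ≡ foreign x M
  news-own x M = filter-≐ _ _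
    ( (λ {e} lt eq → <⇒≢ lt (trans (cong (until (toℕ x)) (sym eq)) refl))
    , (λ {e} owner≢x → subst₂ _<_ (sym (until-own x)) (sym (until-other x (owner e) owner≢x)) (s≤s z≤n))) M

  -- The turn of `x` brings all other agents one turn closer to theirs, so the comparisons do not
  -- change. The entries of `x` that are dropped were news to nobody, as nobody acts before `x`.
  news-foreign : ∀ x y → y ≢ x → ∀ M → news (suc (toℕ x)) y (foreign x M) ≡ news (toℕ x) y M
  news-foreign x y y≢x [] = refl
  news-foreign x y y≢x (e ∷ M) = go (owner e ≟ x)
    where
    i = toℕ x
    new? : ∀ i → Decidable (λ e → until i y < until i (owner e))
    new? i e = until i y ℕ.<? until i (owner e)
    foreign? : Decidable (λ e → ¬ owner e ≡ x)
    foreign? e = ¬? (owner e ≟ x)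
    ih = news-foreign x y y≢x M
    go : Dec (owner e ≡ x) → news (suc i) y (foreign x (e ∷ M)) ≡ news i y (e ∷ M)
    go (yes eq) = trans (cong (news (suc i) y) (filter-reject foreign? {x = e} {M} (λ neq → neq eq)))
      (trans ih (sym (filter-reject (new? i) {x = e} {M} λ lt →
        n≮0 (subst (until i y <_) (trans (cong (until i) eq) (until-own x)) lt))))
    go (no neq) = trans (cong (news (suc i) y) (filter-accept foreign? {x = e} {M} neq)) (by-news (new? i e))
      where
      by-news : Dec (until i y < until i (owner e)) → news (suc i) y (e ∷ foreign x M) ≡ news i y (e ∷ M)
      by-news (yes lt) = trans
        (filter-accept (new? (suc i)) {x = e} {foreign x M}
          (s≤s⁻¹ (subst₂ _<_ (until-other x y y≢x) (until-other x (owner e) neq) lt)))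
        (trans (cong (e ∷_) ih) (sym (filter-accept (new? i) {x = e} {M} lt)))
      by-news (no ≮)   = trans
        (filter-reject (new? (suc i)) {x = e} {foreign x M}
          (λ lt → ≮ (subst₂ _<_ (sym (until-other x y y≢x)) (sym (until-other x (owner e) neq)) (s≤s lt))))
        (trans ih (sym (filter-reject (new? i) {x = e} {M} ≮)))

  news-wrap : ∀ y M → news n y M ≡ news 0 y M
  news-wrap y = filter-≐ _ _
    ( (λ {e} → subst₂ _<_ (wrap y) (wrap (owner e)))
    , (λ {e} → subst₂ _<_ (sym (wrap y)) (sym (wrap (owner e)))))
    where
    wrap : ∀ y → until n y ≡ until 0 y
    wrap y = delay-wrap n (toℕ<n y)

  hops-wrap : ∀ M → hopsLeft n M ≡ hopsLeft 0 M
  hops-wrap []      = refl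
  hops-wrap (e ∷ M) = cong₂ _+_ (delay-wrap n (toℕ<n (owner e))) (hops-wrap M)

  hops-++ : ∀ i M N → hopsLeft i (M ++ N) ≡ hopsLeft i M + hopsLeft i N
  hops-++ i []      N = refl
  hops-++ i (e ∷ M) N = trans (cong (until i (owner e) +_) (hops-++ i M N)) (sym (+-assoc (until i (owner e)) _ _))

  hops-foreign : ∀ x M → length (foreign x M) + hopsLeft (suc (toℕ x)) (foreign x M) ≡ hopsLeft (toℕ x) M
  hops-foreign x [] = refl
  hops-foreign x (e ∷ M) = go (owner e ≟ x)
    where
    i = toℕ x
    foreign? : Decidable (λ e → ¬ owner e ≡ x)
    foreign? e = ¬? (owner e ≟ x)
    lemma : ∀ l u h → suc l + (u + h) ≡ suc u + (l + h)
    lemma = solve-∀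
    go : Dec (owner e ≡ x) →
         length (foreign x (e ∷ M)) + hopsLeft (suc i) (foreign x (e ∷ M)) ≡ hopsLeft i (e ∷ M)
    go (yes eq) = trans (cong (λ N → length N + hopsLeft (suc i) N)
        (filter-reject foreign? {x = e} {M} (λ neq → neq eq)))
      (trans (hops-foreign x M) (cong (_+ hopsLeft i M) (sym (trans (cong (until i) eq) (until-own x)))))
    go (no neq) = trans (cong (λ N → length N + hopsLeft (suc i) N) (filter-accept foreign? {x = e} {M} neq))
      (trans (lemma (length (foreign x M)) (until (suc i) (owner e)) _)
        (cong₂ _+_ (sym (until-other x (owner e) neq)) (hops-foreign x M)))

  hops-own : ∀ x {M} → All (λ e → owner e ≡ x) M → length M + hopsLeft (suc (toℕ x)) M ≡ n * length M
  hops-own x []                    = sym (*-zeroʳ n)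
  hops-own x {e ∷ M} (refl ∷ all) = begin
    suc (length M) + (until (suc (toℕ x)) x + hopsLeft (suc (toℕ x)) M)
      ≡⟨ cong (λ u → suc (length M) + (u + hopsLeft (suc (toℕ x)) M)) (delay-reset n′ (toℕ x)) ⟩
    suc (length M) + (n′ + hopsLeft (suc (toℕ x)) M)
      ≡⟨ lemma (length M) n′ _ ⟩
    n + (length M + hopsLeft (suc (toℕ x)) M)
      ≡⟨ cong (n +_) (hops-own x all) ⟩
    n + n * length M
      ≡⟨ *-suc n (length M) ⟨
    n * suc (length M) ∎
    where
    open ≡-Reasoning
    lemma : ∀ l k h → suc l + (k + h) ≡ suc k + (l + h)
    lemma = solve-∀

  -- An entry leaves the message at the next turn of its owner, so it is news to `y` exactly if `y`
  -- acts earlier. The equation is one of lists: what `y` has not heard is the most recent part of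
  -- `es`, and all agents end up with the same list.
  Knows : ℕ → List (Entry n m) → List (Entry n m) → Fin n → List (Entry n m) → Set
  Knows i es M y known = es ≡ news i y M ++ known

  -- Turn i of rotation ρ, the agents from i on having R + 1 turns left; es lists all
  -- decisions and M those in the message under way.
  record Run (ρ i R : ℕ) (es M : List (Entry n m)) : Set where
    field
      before  : ∀ y → toℕ y < i → ∃ λ known → mode (time ρ i) y ≡ running R known × Knows i es M y known
      after   : ∀ y → i ≤ toℕ y → ∃ λ known → mode (time ρ i) y ≡ running (suc R) known × Knows i es M y known
      carried : unpack (incoming (time ρ i)) ≡ M
      greedy  : NearGreedy Q s es
      -- The agents before `i` have already taken what they could at the lower threshold; the bound
      -- for the others dates from the previous rotation.
      bounded : Bounded (λ j y → (toℕ y < i → Cap R (Q j y)) × Cap (suc R) (Q j y)) es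
      charged : sentMessages (time ρ i) + d * hopsLeft i M ≡ n + n + d * (n * length es)
      -- In the last rotation nothing is decided and every agent removes its own entries, so the
      -- message is empty at the end and nothing is news to anybody.
      last    : R ≡ 0 → Complete es × All (λ e → i ≤ toℕ (owner e)) M

  module Turn (ρ R : ℕ) (x : Fin n) (es M : List (Entry n m)) (r : Run ρ (toℕ x) R es M)
              (known : List (Entry n m)) (mode≡ : mode (time ρ (toℕ x)) x ≡ running (suc R) known)
              (knows : Knows (toℕ x) es M x known) where

    open Run r
    i = toℕ x
    t = time ρ i
    kept = foreign x M
    accept? : Decidable (λ j → ¬ Cap R (column x j))
    accept? j = ¬? (cap? R (column x j))
    foreign? : Decidable (λ e → ¬ owner e ≡ x)
    foreign? e = ¬? (owner e ≟ x)
    new = chosen x (column x) R es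
    es′ = new ++ es
    M′ = new ++ kept
    es≡ : es ≡ kept ++ known
    es≡ = trans knows (cong (_++ known) (news-own x M))
    turn≡ : turn x (column x) ρ (incoming t) (mode t x) ≡ (running R es′ , pack M′)
    turn≡ = trans (cong (turn x (column x) ρ (incoming t)) mode≡)
      (trans (cong (λ N → running R (chosen x (column x) R (foreign x N ++ known) ++ foreign x N ++ known)
                        , pack (chosen x (column x) R (foreign x N ++ known) ++ foreign x N)) carried)
        (cong (λ E → running R (chosen x (column x) R E ++ E) , pack (chosen x (column x) R E ++ kept)) (sym es≡)))
    open Advance (advance-in ρ x (cong (colorsOf x) mode≡))

    own : All (λ e → owner e ≡ x) new
    own = grab-owner x accept? (List.allFin m) {[]} es []

    grabbed : NearGreedy Q s es′ × Bounded (λ j y → (toℕ y < i → Cap R (Q j y)) × Cap (suc R) (Q j y)) es′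
    grabbed = grab-run x accept? (λ (_ , cap) ¬cap → cap-near R cap ¬cap) (List.allFin m) {[]} es greedy bounded

    cap′ : ∀ j y → Free j es′ → Open es′ y → toℕ y < i ⊎ toℕ y ≡ i → Cap R (Q j y)
    cap′ j y free open-y (inj₁ y<i) = proj₁ (proj₂ grabbed j y free open-y) y<i
    cap′ j y free open-y (inj₂ y≡i) with toℕ-injective y≡i
    ... | refl = decidable-stable (cap? R (Q j x))
          (grab-rejects x accept? (List.allFin m) {[]} es (∈-allFin j) free open-y)

    others : ∀ y → y ≢ x → ∀ {known-y} → Knows i es M y known-y → Knows (suc i) es′ M′ y known-y
    others y y≢x {known-y} knows-y = begin
      new ++ es                                                       ≡⟨ cong (new ++_) knows-y ⟩
      new ++ (news i y M ++ known-y)                                  ≡⟨ ++-assoc new _ _ ⟨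
      (new ++ news i y M) ++ known-y                                  ≡⟨ cong (_++ known-y) (begin
        new ++ news i y M                               ≡⟨ cong₂ _++_ all-new (news-foreign x y y≢x M) ⟨
        news (suc i) y new ++ news (suc i) y kept       ≡⟨ filter-++ _ new kept ⟨
        news (suc i) y (new ++ kept)                    ∎) ⟩
      news (suc i) y (new ++ kept) ++ known-y                         ∎
      where
      open ≡-Reasoning
      -- After its turn `x` waits n - 1 further turns, longer than any other agent, so its new
      -- decisions are news to all of them.
      all-new : news (suc i) y new ≡ new
      all-new = filter-all _ (All.map (λ {e} eq → ≤-trans
        (subst (_≤ n′) (until-other x y y≢x) (s≤s⁻¹ (delay-max n (<⇒≤ (toℕ<n x)) (toℕ<n y))))
        (≤-reflexive (sym (trans (cong (until (suc i)) eq) (delay-reset n′ i))))) own)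

    before′ : ∀ y → toℕ y < i ⊎ toℕ y ≡ i →
              ∃ λ known → mode (suc t) y ≡ running R known × Knows (suc i) es′ M′ y known
    before′ y (inj₁ y<i) =
      let y≢x = λ { refl → <-irrefl refl y<i }
          (known-y , mode-y , knows-y) = before y y<i
      in known-y , trans (mode-idle y y≢x) mode-y , others y y≢x knows-y
    before′ y (inj₂ y≡i) with toℕ-injective y≡i
    ... | refl = es′ , trans mode-active (cong proj₁ turn≡) ,
          sym (cong (_++ es′) (filter-none _ {xs = M′} (All.universal (λ e lt →
            <⇒≱ (subst (_< until (suc i) (owner e)) (delay-reset n′ i) lt) (until-max x (owner e))) M′)))

    later : ∀ {N} → All (λ e → i ≤ toℕ (owner e) × owner e ≢ x) N → All (λ e → i < toℕ (owner e)) N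
    later = All.map λ (i≤ , ≢x) → ≤∧≢⇒< i≤ (λ eq → ≢x (toℕ-injective (sym eq)))

    hops : length M′ + hopsLeft (suc i) M′ ≡ hopsLeft i M + n * length new
    hops = begin
      length M′ + hopsLeft (suc i) M′
        ≡⟨ cong₂ _+_ (length-++ new) (hops-++ (suc i) new kept) ⟩
      (length new + length kept) + (hopsLeft (suc i) new + hopsLeft (suc i) kept)
        ≡⟨ lemma (length new) (length kept) _ _ ⟩
      (length kept + hopsLeft (suc i) kept) + (length new + hopsLeft (suc i) new)
        ≡⟨ cong₂ _+_ (hops-foreign x M) (hops-own x own) ⟩
      hopsLeft i M + n * length new ∎
      where
      open ≡-Reasoning
      lemma : ∀ a b c d → (a + b) + (c + d) ≡ (b + d) + (a + c)
      lemma = solve-∀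

    charged′ : sentMessages (suc t) + d * hopsLeft (suc i) M′ ≡ n + n + d * (n * length es′)
    charged′ = begin
      sentMessages (suc t) + d * hopsLeft (suc i) M′
        ≡⟨ cong (_+ d * hopsLeft (suc i) M′) (trans messages≡
            (cong (λ o → sentMessages t + messageCost n o) (cong proj₂ turn≡))) ⟩
      sentMessages t + messageCost n (pack M′) + d * hopsLeft (suc i) M′
        ≡⟨ cong (λ c → sentMessages t + c + d * hopsLeft (suc i) M′) (pack-cost n m d M′) ⟩
      sentMessages t + d * length M′ + d * hopsLeft (suc i) M′
        ≡⟨ lemma₁ (sentMessages t) d (length M′) _ ⟩
      sentMessages t + d * (length M′ + hopsLeft (suc i) M′)
        ≡⟨ cong (λ h → sentMessages t + d * h) hops ⟩
      sentMessages t + d * (hopsLeft i M + n * length new)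
        ≡⟨ lemma₂ (sentMessages t) d (hopsLeft i M) (n * length new) ⟩
      (sentMessages t + d * hopsLeft i M) + d * (n * length new)
        ≡⟨ cong (_+ d * (n * length new)) charged ⟩
      n + n + d * (n * length es) + d * (n * length new)
        ≡⟨ lemma₃ n d (length es) (length new) ⟩
      n + n + d * (n * (length new + length es))
        ≡⟨ cong (λ l → n + n + d * (n * l)) (length-++ new) ⟨
      n + n + d * (n * length es′) ∎
      where
      open ≡-Reasoning
      lemma₁ : ∀ u d l h → u + d * l + d * h ≡ u + d * (l + h)
      lemma₁ = solve-∀
      lemma₂ : ∀ u d h k → u + d * (h + k) ≡ (u + d * h) + d * k
      lemma₂ = solve-∀
      lemma₃ : ∀ n d e l → n + n + d * (n * e) + d * (n * l) ≡ n + n + d * (n * (l + e))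
      lemma₃ = solve-∀

    next-run : Run ρ (suc (toℕ x)) R es′ M′
    next-run = record
      { before  = λ y y≤i → before′ y (m≤n⇒m<n∨m≡n (s≤s⁻¹ y≤i))
      ; after   = λ y i<y → let y≢x = λ { refl → <-irrefl refl i<y }
                                (known-y , mode-y , knows-y) = after y (<⇒≤ i<y)
                            in known-y , trans (mode-idle y y≢x) mode-y , others y y≢x knows-y
      ; carried = trans (cong unpack (trans incoming≡ (cong proj₂ turn≡)))
                    (unpack-pack wide (>-nonZero⁻¹ _ {{m*n≢0 d (suc ⌊log₂ n ⌋)}}) M′)
      ; greedy  = proj₁ grabbed
      ; bounded = λ j y free open-y → (λ y≤i → cap′ j y free open-y (m≤n⇒m<n∨m≡n (s≤s⁻¹ y≤i)))
                                    , proj₂ (proj₂ grabbed j y free open-y)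
      ; charged = charged′
      ; last    = λ R≡0 → let (complete , owners) = last R≡0
                              none = grab-complete x accept? (List.allFin m) {[]} es complete
                          in subst (λ N → Complete (N ++ es)) (sym none) complete
                           , subst (λ N → All (λ e → i < toℕ (owner e)) (N ++ kept)) (sym none)
                               (later (All.zip (filter⁺ foreign? owners , all-filter foreign? M)))
      }

  run-turn : ∀ ρ R (x : Fin n) → (∃ λ es → ∃ λ M → Run ρ (toℕ x) R es M) →
             ∃ λ es → ∃ λ M → Run ρ (suc (toℕ x)) R es M
  run-turn ρ R x (es , M , r) = es′ , M′ , next-run
    where
    agent-x = Run.after r x ≤-refl
    open Turn ρ R x es M r (proj₁ agent-x) (proj₁ (proj₂ agent-x)) (proj₂ (proj₂ agent-x))

  run-next : ∀ {ρ R es M} → Run ρ n (suc R) es M → Run (suc ρ) 0 R es M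
  run-next {ρ} {R} {es} {M} r = record
    { before  = λ _ ()
    ; after   = λ y _ → let (known , mode≡ , knows) = before y (toℕ<n y)
                        in known , mode≡ , trans knows (cong (_++ known) (news-wrap y M))
    ; carried = carried
    ; greedy  = greedy
    ; bounded = λ j y free open-y → (λ ()) , cap j y free open-y
    ; charged = trans (cong (λ h → sentMessages (time (suc ρ) 0) + d * h) (sym (hops-wrap M))) charged
    -- `Cap 1` is empty, so no pair is available any more: the assignment is complete before the
    -- last rotation begins.
    ; last    = λ { refl → exhausted⇒complete {Q = Q} {s} es cap , All.universal (λ _ → z≤n) M }
    }
    where
    open Run r
    cap : ∀ j y → Free j es → Open es y → Cap (suc R) (Q j y)
    cap j y free open-y = proj₁ (bounded j y free open-y) (toℕ<n y)

  run-all : ∀ R ρ → (∃ λ es → ∃ λ M → Run ρ 0 R es M) → ∃ λ es → ∃ λ M → Run (R + ρ) n 0 es M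
  run-all R ρ start with over-rotation (λ i → ∃ λ es → ∃ λ M → Run ρ i R es M) (run-turn ρ R) start
  run-all zero    ρ start | end         = end
  run-all (suc R) ρ start | es , M , r = subst (λ k → ∃ λ es → ∃ λ M → Run k n 0 es M) (+-suc R ρ)
    (run-all R (suc ρ) (es , M , run-next r))

  run-start : ∀ {ρ} → Climb ρ n n → Run (2 + ρ) 0 (suc ρ) [] []
  run-start {ρ} c = record
    { before  = λ _ ()
    ; after   = λ y _ → [] , Launch.launched l y (toℕ<n y) , refl
    ; carried = cong unpack (Launch.signal l)
    ; greedy  = []
    ; bounded = λ j y _ _ → (λ ()) , proj₂ (Climb.done c y (toℕ<n y)) j
    ; charged = trans (cong (_+ d * 0) (Launch.charged l)) (cong (λ u → n + n + d * u) (sym (*-zeroʳ n)))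
    ; last    = λ ()
    }
    where
    l = launch c

  record Result (T : ℕ) : Set where
    field
      π        : Assignment n m
      computes : Computes (algorithm s d) Q T π
      balanced : Balanced π
      approx   : (o : Assignment n m) → Balanced o → s * cost Q π ≤ (2 * s + 2) * cost Q o
      messages-sent : sentMessages T ≡ n + n + d * (n * m)

  run-result : ∀ {ρ es M} → Run ρ n 0 es M → Result (time ρ n)
  run-result {ρ} {es} {M} r = record
    { π             = π
    ; computes      = λ y → colors y , output≡ y , λ j → mk⇔ (sound y j) (full y j)
    ; balanced      = run-balanced greedy complete
    ; approx        = run-approx greedy complete
    ; messages-sent = trans (sym (trans (cong (λ N → sentMessages (time ρ n) + d * hopsLeft n N) M≡[])
                        (trans (cong (sentMessages (time ρ n) +_) (*-zeroʳ d)) (+-identityʳ _))))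
                        (trans charged (cong (λ l → n + n + d * (n * l)) (run-length greedy complete)))
    }
    where
    open Run r
    complete : Complete es
    complete = proj₁ (last refl)
    π : Assignment n m
    π = total es complete
    none : ∀ {N} → All (λ e → n ≤ toℕ (owner e)) N → N ≡ []
    none []              = refl
    none {e ∷ _} (n≤ ∷ _) = contradiction (toℕ<n (owner e)) (≤⇒≯ n≤)
    M≡[] : M ≡ []
    M≡[] = none (proj₂ (last refl))
    colors : Fin n → Subset m
    colors y = Vec.tabulate λ j → does (owned? es y j)
    mode≡ : ∀ y → mode (time ρ n) y ≡ running 0 es
    mode≡ y with before y (toℕ<n y)
    ... | known , eq , knows = trans eq
        (cong (running 0) (sym (trans knows (cong (λ N → news n y N ++ known) M≡[]))))
    output≡ : ∀ y → colorsOf y (mode (time ρ n) y) ≡ just (colors y)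
    output≡ y = cong (colorsOf y) (mode≡ y)
    sound : ∀ y j → j ∈ colors y → π j ≡ y
    sound y j j∈ with owned? es y j | trans (sym (lookup∘tabulate (λ j → does (owned? es y j)) j)) ([]=⇒lookup j∈)
    ... | yes owned | _ = just-injective (trans (sym (proj₂ (complete j))) owned)
    full : ∀ y j → π j ≡ y → j ∈ colors y
    full y j refl = lookup⇒[]= j (colors y)
      (trans (lookup∘tabulate (λ j → does (owned? es y j)) j) (dec-true (owned? es (π j) j) (proj₂ (complete j))))

  climbed⇒result : ∀ {k} → Climb k n n → Result ((2 * k + 4) * n)
  climbed⇒result {k} c =
    let (es , M , r) = run-all (suc k) (2 + k) ([] , [] , run-start c)
    in subst (λ l → Result (l * n)) (lemma k) (run-result r)
    where
    lemma : ∀ k → suc (suc k + (2 + k)) ≡ 2 * k + 4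
    lemma = solve-∀

  protocol-result : ∃ λ k → Early k × Result ((2 * k + 4) * n)
  protocol-result = let (k , early , c) = climbed in k , early , climbed⇒result c

-- Rational estimates

unit : ℕ → ℚ
unit k = ℤ.+ 1 ℚ./ suc k

toℚᵘ-fromℕ : ∀ a → toℚᵘ (fromℕ a) ℚᵘ.≃ mkℚᵘ (ℤ.+ a) 0
toℚᵘ-fromℕ a = ℚ.toℚᵘ-fromℚᵘ (mkℚᵘ (ℤ.+ a) 0)

toℚᵘ-unit : ∀ k → toℚᵘ (unit k) ℚᵘ.≃ mkℚᵘ (ℤ.+ 1) k
toℚᵘ-unit k = ℚ.toℚᵘ-fromℚᵘ (mkℚᵘ (ℤ.+ 1) k)

fromℕ-+ : ∀ a b → fromℕ (a + b) ≡ fromℕ a ℚ.+ fromℕ b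
fromℕ-+ a b = ℚ.toℚᵘ-injective (ℚᵘ.≃-trans (toℚᵘ-fromℕ (a + b)) (ℚᵘ.≃-sym
  (ℚᵘ.≃-trans (ℚ.toℚᵘ-homo-+ (fromℕ a) (fromℕ b))
    (ℚᵘ.≃-trans (ℚᵘ.+-cong (toℚᵘ-fromℕ a) (toℚᵘ-fromℕ b))
      (*≡* (cong (ℤ._* ℤ.+ 1)
          (trans (cong₂ ℤ._+_ (ℤ.*-identityʳ (ℤ.+ a)) (ℤ.*-identityʳ (ℤ.+ b))) (sym (ℤ.pos-+ a b)))))))))

fromℕ-* : ∀ a b → fromℕ (a * b) ≡ fromℕ a ℚ.* fromℕ b
fromℕ-* a b = ℚ.toℚᵘ-injective (ℚᵘ.≃-trans (toℚᵘ-fromℕ (a * b)) (ℚᵘ.≃-sym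
  (ℚᵘ.≃-trans (ℚ.toℚᵘ-homo-* (fromℕ a) (fromℕ b))
    (ℚᵘ.≃-trans (ℚᵘ.*-cong (toℚᵘ-fromℕ a) (toℚᵘ-fromℕ b))
      (*≡* (cong (ℤ._* ℤ.+ 1) (sym (ℤ.pos-* a b))))))))

fromℕ-mono : ∀ {a b} → a ≤ b → fromℕ a ℚ.≤ fromℕ b
fromℕ-mono {a} {b} a≤b = ℚ.toℚᵘ-cancel-≤
  (ℚᵘ.≤-respˡ-≃ (ℚᵘ.≃-sym (toℚᵘ-fromℕ a)) (ℚᵘ.≤-respʳ-≃ (ℚᵘ.≃-sym (toℚᵘ-fromℕ b))
    (*≤* (ℤ.*-monoʳ-≤-nonNeg (ℤ.+ 1) (ℤ.+≤+ a≤b)))))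

fromℕ-^ : ∀ a k → fromℕ (a ^ k) ≡ fromℕ a ^ℚ k
fromℕ-^ a zero    = refl
fromℕ-^ a (suc k) = trans (fromℕ-* a (a ^ k)) (cong (fromℕ a ℚ.*_) (fromℕ-^ a k))

fromℕ-unit : ∀ k → fromℕ (suc k) ℚ.* unit k ≡ 1ℚ
fromℕ-unit k = ℚ.toℚᵘ-injective
  (ℚᵘ.≃-trans (ℚ.toℚᵘ-homo-* (fromℕ (suc k)) (unit k))
    (ℚᵘ.≃-trans (ℚᵘ.*-cong (toℚᵘ-fromℕ (suc k)) (toℚᵘ-unit k))
      (*≡* (cong ℤ.+_ (lemma k)))))
  where
  lemma : ∀ k → suc k * 1 * 1 ≡ 1 * (1 * suc k)
  lemma = solve-∀

unit-mono : ∀ {j k} → j < k → unit k ℚ.< unit j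
unit-mono {j} {k} j<k = ℚ.toℚᵘ-cancel-<
  (ℚᵘ.<-respˡ-≃ (ℚᵘ.≃-sym (toℚᵘ-unit k)) (ℚᵘ.<-respʳ-≃ (ℚᵘ.≃-sym (toℚᵘ-unit j))
    (*<* (ℤ.*-monoˡ-<-pos (ℤ.+ 1) (ℤ.+<+ (s≤s j<k))))))

archimedean : ∀ r → 0ℚ ℚ.< r → ∃ λ k → unit k ℚ.< r
archimedean r@(mkℚ (ℤ.+ suc a) k _) _ = suc k , ℚ.toℚᵘ-cancel-<
  (ℚᵘ.<-respˡ-≃ (ℚᵘ.≃-sym (toℚᵘ-unit (suc k)))
    (*<* (ℤ.+<+ (≤-trans (s≤s (≤-reflexive (*-identityˡ (suc k))))
      (m≤n*m (suc (suc k)) (suc a))))))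
archimedean (mkℚ (ℤ.+ zero) k _) (ℚ.*<* (ℤ.+<+ ()))
archimedean (mkℚ -[1+ a ] k _) (ℚ.*<* ())

module _ (ε : ℝ) where
  open ℝ ε

  lower-≤ : ∀ {q r} → q ℚ.< r → lower r → lower q
  lower-≤ {q} {r} q<r r<ε = Equivalence.from (lower-rounded q) (r , q<r , r<ε)

  between : ∀ {q r} → lower q → upper r → q ℚ.≤ r
  between {q} {r} q<ε ε<r = ℚ.≮⇒≥ λ r<q → disjoint r (lower-≤ r<q q<ε , ε<r)

  -- The order between ε and a rational is not decidable; `located` only chooses between 1/(v + 3) <
  -- ε and ε < 1/(v + 2). Stopping at the first answer of the former kind leaves an interval with a
  -- gap. The search ends because some unit fraction lies below ε.
  bracket : 0ℚ <ℝ ε → ε ℝ< 1ℚ → ∃ λ v → unit (2 + v) <ℝ ε × ε ℝ< unit v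
  bracket 0<ε ε<1 = let (r , 0<r , r<ε) = Equivalence.to (lower-rounded 0ℚ) 0<ε
                        (k , 1/k<r) = archimedean r 0<r
                    in search k 0 (subst (λ u → lower (unit u)) (sym (+-identityʳ k)) (lower-≤ 1/k<r r<ε)) ε<1
    where
    search : ∀ fuel v → lower (unit (fuel + v)) → upper (unit v) → ∃ λ v → lower (unit (2 + v)) × upper (unit v)
    search zero       v low up = contradiction (low , up) (disjoint (unit v))
    search (suc fuel) v low up with located (unit (2 + v)) (unit (1 + v)) (unit-mono {1 + v} ≤-refl)
    ... | inj₁ below = v , below , up
    ... | inj₂ above = search fuel (suc v) (subst (λ u → lower (unit u)) (sym (+-suc fuel v)) low) above

fromℕ-nonNeg : ∀ a → ℚ.NonNegative (fromℕ a)
fromℕ-nonNeg a = ℚ.nonNegative (fromℕ-mono (z≤n {a}))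

fromℕ-pos : ∀ a .{{_ : NonZero a}} → ℚ.Positive (fromℕ a)
fromℕ-pos (suc a) = ℚ.normalize-pos (suc a) 1

approx-from-ℕ : ∀ k c o q → unit k ℚ.≤ q → suc k * c ≤ suc (2 * suc k) * o →
                fromℕ c ℚ.≤ (fromℕ 2 ℚ.+ q) ℚ.* fromℕ o
approx-from-ℕ k c o q u≤q h = ℚ.≤-trans
  (ℚ.*-cancelˡ-≤-pos (fromℕ (suc k)) {{fromℕ-pos (suc k)}} (begin
    fromℕ (suc k) ℚ.* fromℕ c                                 ≡⟨ fromℕ-* (suc k) c ⟨
    fromℕ (suc k * c)                                         ≤⟨ fromℕ-mono h ⟩
    fromℕ (suc (2 * suc k) * o)                               ≡⟨ fromℕ-* (suc (2 * suc k)) o ⟩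
    fromℕ (suc (2 * suc k)) ℚ.* fromℕ o                       ≡⟨ cong (ℚ._* fromℕ o) factor ⟩
    fromℕ (suc k) ℚ.* (fromℕ 2 ℚ.+ unit k) ℚ.* fromℕ o        ≡⟨ ℚ.*-assoc (fromℕ (suc k)) _ _ ⟩
    fromℕ (suc k) ℚ.* ((fromℕ 2 ℚ.+ unit k) ℚ.* fromℕ o)      ∎))
  (ℚ.*-monoʳ-≤-nonNeg (fromℕ o) {{fromℕ-nonNeg o}} (ℚ.+-monoʳ-≤ (fromℕ 2) u≤q))
  where
  open ℚ.≤-Reasoning
  factor : fromℕ (suc (2 * suc k)) ≡ fromℕ (suc k) ℚ.* (fromℕ 2 ℚ.+ unit k)
  factor = ≡.begin
    fromℕ (suc (2 * suc k))                                   ≡.≡⟨ cong fromℕ (+-comm 1 (2 * suc k)) ⟩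
    fromℕ (2 * suc k + 1)                                     ≡.≡⟨ fromℕ-+ (2 * suc k) 1 ⟩
    fromℕ (2 * suc k) ℚ.+ 1ℚ                                  ≡.≡⟨ cong₂ ℚ._+_
        (trans (cong fromℕ (*-comm 2 (suc k))) (fromℕ-* (suc k) 2)) (sym (fromℕ-unit k)) ⟩
    fromℕ (suc k) ℚ.* fromℕ 2 ℚ.+ fromℕ (suc k) ℚ.* unit k    ≡.≡⟨ ℚ.*-distribˡ-+ (fromℕ (suc k)) (fromℕ 2) (unit k) ⟨
    fromℕ (suc k) ℚ.* (fromℕ 2 ℚ.+ unit k)                    ≡.∎
    where module ≡ = ≡-Reasoning

^-nonNeg : ∀ x k → 0ℚ ℚ.≤ x → 0ℚ ℚ.≤ x ^ℚ k
^-nonNeg x zero    0≤x = fromℕ-mono (z≤n {1})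
^-nonNeg x (suc k) 0≤x = ℚ.≤-trans (ℚ.≤-reflexive (sym (ℚ.*-zeroʳ x)))
  (ℚ.*-monoˡ-≤-nonNeg x {{ℚ.nonNegative 0≤x}} (^-nonNeg x k 0≤x))

^-mono : ∀ {x y} k → 0ℚ ℚ.≤ x → x ℚ.≤ y → x ^ℚ k ℚ.≤ y ^ℚ k
^-mono         zero    0≤x x≤y = ℚ.≤-refl
^-mono {x} {y} (suc k) 0≤x x≤y = ℚ.≤-trans
  (ℚ.*-monoˡ-≤-nonNeg x {{ℚ.nonNegative 0≤x}} (^-mono k 0≤x x≤y))
  (ℚ.*-monoʳ-≤-nonNeg (y ^ℚ k) {{ℚ.nonNegative (^-nonNeg y k (ℚ.≤-trans 0≤x x≤y))}} x≤y)

bernoulli-ℚ : ∀ x k → 0ℚ ℚ.≤ x → 1ℚ ℚ.+ fromℕ k ℚ.* x ℚ.≤ (1ℚ ℚ.+ x) ^ℚ k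
bernoulli-ℚ x zero    0≤x = ℚ.≤-reflexive (trans (cong (1ℚ ℚ.+_) (ℚ.*-zeroˡ x)) (ℚ.+-identityʳ 1ℚ))
bernoulli-ℚ x (suc k) 0≤x = begin
  1ℚ ℚ.+ fromℕ (suc k) ℚ.* x                ≡⟨ expand ⟩
  (1ℚ ℚ.+ y) ℚ.+ x ℚ.* 1ℚ
    ≤⟨ ℚ.+-monoʳ-≤ (1ℚ ℚ.+ y) (ℚ.*-monoˡ-≤-nonNeg x {{nn}}
        (ℚ.≤-trans (ℚ.≤-reflexive (sym (ℚ.+-identityʳ 1ℚ))) (ℚ.+-monoʳ-≤ 1ℚ 0≤y))) ⟩
  (1ℚ ℚ.+ y) ℚ.+ x ℚ.* (1ℚ ℚ.+ y)           ≡⟨ cong (ℚ._+ x ℚ.* (1ℚ ℚ.+ y)) (ℚ.*-identityˡ (1ℚ ℚ.+ y)) ⟨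
  1ℚ ℚ.* (1ℚ ℚ.+ y) ℚ.+ x ℚ.* (1ℚ ℚ.+ y)    ≡⟨ ℚ.*-distribʳ-+ (1ℚ ℚ.+ y) 1ℚ x ⟨
  (1ℚ ℚ.+ x) ℚ.* (1ℚ ℚ.+ y)
    ≤⟨ ℚ.*-monoˡ-≤-nonNeg (1ℚ ℚ.+ x) {{ℚ.nonNegative (ℚ.+-mono-≤ (fromℕ-mono (z≤n {1})) 0≤x)}}
        (bernoulli-ℚ x k 0≤x) ⟩
  (1ℚ ℚ.+ x) ^ℚ suc k                       ∎
  where
  open ℚ.≤-Reasoning
  y = fromℕ k ℚ.* x
  nn = ℚ.nonNegative 0≤x
  0≤y : 0ℚ ℚ.≤ y
  0≤y = ℚ.≤-trans (ℚ.≤-reflexive (sym (ℚ.*-zeroʳ (fromℕ k)))) (ℚ.*-monoˡ-≤-nonNeg (fromℕ k) {{fromℕ-nonNeg k}} 0≤x)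
  expand : 1ℚ ℚ.+ fromℕ (suc k) ℚ.* x ≡ (1ℚ ℚ.+ y) ℚ.+ x ℚ.* 1ℚ
  expand = trans (cong (1ℚ ℚ.+_)
      (trans (cong (λ u → u ℚ.* x) (trans (cong fromℕ (+-comm 1 k)) (fromℕ-+ k 1)))
        (trans (ℚ.*-distribʳ-+ x (fromℕ k) 1ℚ) (cong (y ℚ.+_) (ℚ.*-comm 1ℚ x)))))
    (sym (ℚ.+-assoc 1ℚ y (x ℚ.* 1ℚ)))

unit≤multiple : ∀ j k c → suc k ≤ suc j * c → unit j ℚ.≤ fromℕ c ℚ.* unit k
unit≤multiple j k c h = ℚ.*-cancelˡ-≤-pos (fromℕ (suc j)) {{fromℕ-pos (suc j)}} (begin
  fromℕ (suc j) ℚ.* unit j                ≡⟨ fromℕ-unit j ⟩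
  1ℚ                                      ≡⟨ fromℕ-unit k ⟨
  fromℕ (suc k) ℚ.* unit k                ≤⟨ ℚ.*-monoʳ-≤-nonNeg (unit k) {{ℚ.normalize-nonNeg 1 (suc k)}} (fromℕ-mono h) ⟩
  fromℕ (suc j * c) ℚ.* unit k            ≡⟨ cong (ℚ._* unit k) (fromℕ-* (suc j) c) ⟩
  fromℕ (suc j) ℚ.* fromℕ c ℚ.* unit k    ≡⟨ ℚ.*-assoc (fromℕ (suc j)) (fromℕ c) (unit k) ⟩
  fromℕ (suc j) ℚ.* (fromℕ c ℚ.* unit k)  ∎)
  where open ℚ.≤-Reasoning

power-from-ℕ : ∀ s′ e B → suc (suc s′) ^ e ≤ B * suc s′ ^ e → (1ℚ ℚ.+ unit s′) ^ℚ e ℚ.≤ fromℕ B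
power-from-ℕ s′ e B h = ℚ.*-cancelʳ-≤-pos (fromℕ (s ^ e)) {{fromℕ-pos (s ^ e) {{m^n≢0 s e}}}} (begin
  w ^ℚ e ℚ.* fromℕ (s ^ e)     ≡⟨ clear e ⟩
  fromℕ (suc s ^ e)            ≤⟨ fromℕ-mono h ⟩
  fromℕ (B * s ^ e)            ≡⟨ fromℕ-* B (s ^ e) ⟩
  fromℕ B ℚ.* fromℕ (s ^ e)    ∎)
  where
  open ℚ.≤-Reasoning
  s = suc s′
  w = 1ℚ ℚ.+ unit s′
  w*s : w ℚ.* fromℕ s ≡ fromℕ (suc s)
  w*s = trans (ℚ.*-distribʳ-+ (fromℕ s) 1ℚ (unit s′))
    (trans (cong₂ ℚ._+_ (ℚ.*-identityˡ (fromℕ s)) (trans (ℚ.*-comm (unit s′) (fromℕ s)) (fromℕ-unit s′)))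
      (trans (sym (fromℕ-+ s 1)) (cong fromℕ (+-comm s 1))))
  clear : ∀ e → w ^ℚ e ℚ.* fromℕ (s ^ e) ≡ fromℕ (suc s ^ e)
  clear zero    = refl
  clear (suc e) = ≡.begin
    w ℚ.* w ^ℚ e ℚ.* fromℕ (s * s ^ e)                 ≡.≡⟨ cong (w ℚ.* w ^ℚ e ℚ.*_) (fromℕ-* s (s ^ e)) ⟩
    w ℚ.* w ^ℚ e ℚ.* (fromℕ s ℚ.* fromℕ (s ^ e))       ≡.≡⟨ interchange w (w ^ℚ e) (fromℕ s) (fromℕ (s ^ e)) ⟩
    (w ℚ.* fromℕ s) ℚ.* (w ^ℚ e ℚ.* fromℕ (s ^ e))     ≡.≡⟨ cong₂ ℚ._*_ w*s (clear e) ⟩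
    fromℕ (suc s) ℚ.* fromℕ (suc s ^ e)                ≡.≡⟨ fromℕ-* (suc s) (suc s ^ e) ⟨
    fromℕ (suc s * suc s ^ e)                          ≡.∎
    where
    module ≡ = ≡-Reasoning
    open CommutativeSemigroupProperties (CommutativeRing.*-commutativeSemigroup ℚ.+-*-commutativeRing)
        using (interchange)

-- By Bernoulli 1 + q ≤ 1 + 6/s ≤ (1 + 1/s) ^ 6, which moves the change of base into the exponent.
log-from-ℕ : ∀ s′ T a P q → 0ℚ ℚ.≤ q → q ℚ.≤ fromℕ 6 ℚ.* unit s′ →
             suc (suc s′) ^ (6 * T) ≤ P ^ a * suc s′ ^ (6 * T) →
             (1ℚ ℚ.+ q) ^ℚ T ℚ.≤ fromℕ P ^ℚ a
log-from-ℕ s′ T a P q 0≤q q≤ h = begin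
  (1ℚ ℚ.+ q) ^ℚ T            ≤⟨ ^-mono T (ℚ.+-mono-≤ (fromℕ-mono (z≤n {1})) 0≤q)
                                  (ℚ.≤-trans (ℚ.+-monoʳ-≤ 1ℚ q≤)
                                  (bernoulli-ℚ (unit s′) 6
                                    (ℚ.nonNegative⁻¹ (unit s′) {{ℚ.normalize-nonNeg 1 (suc s′)}}))) ⟩
  (w ^ℚ 6) ^ℚ T              ≡⟨ ^-assocʳ w 6 T ⟩
  w ^ℚ (6 * T)               ≤⟨ power-from-ℕ s′ (6 * T) (P ^ a) h ⟩
  fromℕ (P ^ a)              ≡⟨ fromℕ-^ P a ⟩
  fromℕ P ^ℚ a               ∎
  where
  open ℚ.≤-Reasoning
  w = 1ℚ ℚ.+ unit s′

-- The number of rounds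

module Growth (X Y P : ℕ) where

  -- For X = s + 1 and Y = s this is e ≤ f * log P to the base 1 + 1/s with denominators cleared;
  -- such estimates can be added and multiplied by constants.
  Grows : ℕ → ℕ → Set
  Grows e f = X ^ e ≤ P ^ f * Y ^ e

  grows-+ : ∀ e f e′ f′ → Grows e f → Grows e′ f′ → Grows (e + e′) (f + f′)
  grows-+ e f e′ f′ g g′ = begin
    X ^ (e + e′)                            ≡⟨ ^-distribˡ-+-* X e e′ ⟩
    X ^ e * X ^ e′                          ≤⟨ *-mono-≤ g g′ ⟩
    P ^ f * Y ^ e * (P ^ f′ * Y ^ e′)       ≡⟨ lemma (P ^ f) (Y ^ e) (P ^ f′) (Y ^ e′) ⟩
    P ^ f * P ^ f′ * (Y ^ e * Y ^ e′)       ≡⟨ cong₂ _*_ (^-distribˡ-+-* P f f′) (^-distribˡ-+-* Y e e′) ⟨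
    P ^ (f + f′) * Y ^ (e + e′)             ∎
    where
    open ≤-Reasoning
    lemma : ∀ a b c d → a * b * (c * d) ≡ a * c * (b * d)
    lemma = solve-∀

  grows-* : ∀ k e f → Grows e f → Grows (k * e) (k * f)
  grows-* zero    e f g = ≤-refl
  grows-* (suc k) e f g = grows-+ e f (k * e) (k * f) g (grows-* k e f g)

-- The factor 6 is due to ε < 6 / s, so that 1 + ε ≤ (1 + 1 / s) ^ 6.
rounds-bound : ∀ s .{{_ : NonZero s}} n k p → (∀ l → k ≡ suc l → ¬ Threshold.Below s l p) →
               suc s ^ (6 * ((2 * k + 4) * n)) ≤ (2 ⊔ p) ^ (48 * n) * s ^ (6 * ((2 * k + 4) * n))
-- The 2 * k rotations need 2 * 2 factors `P` and the other four rotations one each; these 8, times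
-- 6 * n, make 48 * n.
rounds-bound s n k p early = subst₂ Grows
  (lemma₁ n k) (lemma₂ n) (grows-* (6 * n) (2 * k + 4 * 1) 8 (grows-+ (2 * k) 4 (4 * 1) 4
    (grows-* 2 k 2 (level k early)) (grows-* 4 1 1 one)))
  where
  P = 2 ⊔ p
  open Growth (suc s) s P
  open ≤-Reasoning
  lemma₁ : ∀ n k → 6 * n * (2 * k + 4 * 1) ≡ 6 * ((2 * k + 4) * n)
  lemma₁ = solve-∀
  lemma₂ : ∀ n → 6 * n * 8 ≡ 48 * n
  lemma₂ = solve-∀
  1≤s : 1 ≤ s
  1≤s = >-nonZero⁻¹ s
  s+1≤Ps : suc s ≤ P * s
  s+1≤Ps = begin
    1 + s     ≤⟨ +-monoˡ-≤ s 1≤s ⟩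
    s + s     ≡⟨ cong (s +_) (+-identityʳ s) ⟨
    2 * s     ≤⟨ *-monoˡ-≤ s (m≤m⊔n 2 p) ⟩
    P * s     ∎
  one : Grows 1 1
  one = subst₂ _≤_ (sym (*-identityʳ (suc s))) (sym (cong₂ _*_ (*-identityʳ P) (*-identityʳ s))) s+1≤Ps
  -- The previous threshold is at most p, and the last factor 1 + 1/s is at most 2: two factors `P`.
  level : ∀ k → (∀ l → k ≡ suc l → ¬ Threshold.Below s l p) → Grows k 2
  level zero    _     = ≤-trans (*-mono-≤ {1} {P} (<⇒≤ (m≤m⊔n 2 p)) (*-mono-≤ {1} {P} (<⇒≤ (m≤m⊔n 2 p)) ≤-refl))
    (≤-reflexive (sym (*-identityʳ (P * (P * 1)))))
  level (suc l) early = begin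
    suc s * suc s ^ l            ≤⟨ *-mono-≤ s+1≤Ps (≮⇒≥ (early l refl)) ⟩
    P * s * (p * s ^ l)          ≤⟨ *-monoʳ-≤ (P * s) (*-monoˡ-≤ (s ^ l) (m≤n⊔m 2 p)) ⟩
    P * s * (P * s ^ l)          ≡⟨ lemma P s (s ^ l) ⟩
    P ^ 2 * (s * s ^ l)          ∎
    where
    lemma : ∀ P s x → P * s * (P * x) ≡ P * (P * 1) * (s * x)
    lemma = solve-∀

-- Choice of the constants and assembly of the bounds

theorem25 : (c K : ℕ) → ∃ λ (C : ℕ) →
    (ε : ℝ) → 0ℚ <ℝ ε → ε ℝ< 1ℚ →
    Σ Algorithm λ 𝓐 →
    (n m : ℕ) .{{_ : NonZero n}} → n ≤ m → m ≤ K * n ^ c →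
    ((Q : Items n m) →
    ∃ λ (T : ℕ) → ∃ λ (π : Assignment n m) →
    Computes 𝓐 Q T π ×
    Balanced π ×
    ((opt : ℕ) → IsCostOPT Q opt → cost Q π ≤[2+ ε ]* opt) ×
    T ≤ C * n *log[1+ ε ] (2 ⊔ maxItems Q) ×
    messages 𝓐 Q T ≤ C * (n * m)) ×
    (2 ≤ n →
    ∃ λ (Q : Items n m) → ∃ λ (T : ℕ) →
    Halted 𝓐 Q T ×
    n * m ≤ C * messages 𝓐 Q T)
theorem25 c K = C , λ ε 0<ε ε<1 →
  let (v , low , up) = bracket ε 0<ε ε<1
  in algorithm (2 * suc (2 + v)) d , λ { (suc n′) m n≤m m≤ → guarantees ε v low up n′ m n≤m m≤ }
  where
  d C : ℕ
  d = suc (K + c)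
  -- 48 serves the time bound; 2 + d serves the messages, namely the two tours of the empty message
  -- and d * n for each color.
  C = 48 + (2 + d)

  module _ (ε : ℝ) (v : ℕ) (low : unit (2 + v) <ℝ ε) (up : ε ℝ< unit v)
           (n′ m : ℕ) (n≤m : suc n′ ≤ m) (m≤ : m ≤ K * suc n′ ^ c) where

    n s : ℕ
    n = suc n′
    -- Even, so that the excess 2/s of the ratio over 2 is the unit fraction 1/(v + 3), known to lie
    -- below ε.
    s = 2 * suc (2 + v)

    𝓐 : Algorithm
    𝓐 = algorithm s d

    UpperBounds LowerBound : Items n m → ℕ → Assignment n m → Set
    UpperBounds Q T π =
      Computes 𝓐 Q T π ×
      Balanced π ×
      ((opt : ℕ) → IsCostOPT Q opt → cost Q π ≤[2+ ε ]* opt) ×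
      T ≤ C * n *log[1+ ε ] (2 ⊔ maxItems Q) ×
      messages 𝓐 Q T ≤ C * (n * m)
    LowerBound Q T π = n * m ≤ C * messages 𝓐 Q T

    module _ (Q : Items n m) where

      open Running s d n′ m Q (wide-enough c K n m m≤) using (Early; Result)

      bounds : ∀ k → Early k → Result ((2 * k + 4) * n) →
               ∃ λ T → ∃ λ π → UpperBounds Q T π × LowerBound Q T π
      bounds k early r = (2 * k + 4) * n , π ,
        (computes , balanced , cost-bound , time-bound , upper) , lower
        where
        open Result r
        T = (2 * k + 4) * n
        open ≤-Reasoning
        halve : ∀ w x y → 2 * w * x ≤ (2 * (2 * w) + 2) * y → w * x ≤ suc (2 * w) * y
        halve w x y h = *-cancelˡ-≤ 2 (subst₂ _≤_ (*-assoc 2 w x) (lemma w y) h)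
          where
          lemma : ∀ w y → (2 * (2 * w) + 2) * y ≡ 2 * (suc (2 * w) * y)
          lemma = solve-∀
        cost-bound : (opt : ℕ) → IsCostOPT Q opt → cost Q π ≤[2+ ε ]* opt
        cost-bound opt is-opt q ε<q =
          let (σ , σ-balanced , cost≡opt) = IsCostOPT.attained is-opt
          in approx-from-ℕ (2 + v) (cost Q π) opt q (between ε low ε<q)
               (subst (λ o → suc (2 + v) * cost Q π ≤ suc (2 * suc (2 + v)) * o) cost≡opt
                 (halve (suc (2 + v)) (cost Q π) (cost Q σ) (approx σ σ-balanced)))
        time-bound : T ≤ C * n *log[1+ ε ] (2 ⊔ maxItems Q)
        time-bound q 0<q q<ε = log-from-ℕ (pred s) T (C * n) (2 ⊔ maxItems Q) q (ℚ.<⇒≤ 0<q)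
          (ℚ.≤-trans (between ε q<ε up) (unit≤multiple v (pred s) 6 s≤6[v+1]))
          (≤-trans (rounds-bound s n k (maxItems Q) early)
            (*-monoˡ-≤ (s ^ (6 * T)) (^-monoʳ-≤ (2 ⊔ maxItems Q) {{>-nonZero (<⇒≤ (m≤m⊔n 2 (maxItems Q)))}}
              (*-monoˡ-≤ n (m≤m+n 48 (2 + d))))))
          where
          -- This gives ε < 1/(v + 1) ≤ 6/s, the upper estimate of ε needed for the change of base.
          s≤6[v+1] : s ≤ suc v * 6
          s≤6[v+1] = ≤-trans (m≤m+n s (4 * v)) (≤-reflexive (lemma v))
            where
            lemma : ∀ v → 2 * suc (2 + v) + 4 * v ≡ suc v * 6
            lemma = solve-∀
        upper : messages 𝓐 Q T ≤ C * (n * m)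
        upper = begin
          messages 𝓐 Q T                ≡⟨ messages-sent ⟩
          n + n + d * (n * m)           ≤⟨ +-monoˡ-≤ (d * (n * m)) (+-mono-≤ n≤nm n≤nm) ⟩
          n * m + n * m + d * (n * m)   ≡⟨ lemma d (n * m) ⟩
          (2 + d) * (n * m)             ≤⟨ *-monoˡ-≤ (n * m) (m≤n+m (2 + d) 48) ⟩
          C * (n * m)                   ∎
          where
          n≤nm : n ≤ n * m
          n≤nm = m≤m*n n m {{>-nonZero (≤-trans (s≤s z≤n) n≤m)}}
          lemma : ∀ d x → x + x + d * x ≡ (2 + d) * x
          lemma = solve-∀
        lower : LowerBound Q T π
        lower = begin
          n * m                 ≤⟨ m≤m+n (n * m) _ ⟩
          d * (n * m)           ≤⟨ m≤n+m _ (n + n) ⟩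
          n + n + d * (n * m)   ≡⟨ messages-sent ⟨
          messages 𝓐 Q T        ≤⟨ m≤m+n _ _ ⟩
          C * messages 𝓐 Q T    ∎

    outcome : ∀ Q → ∃ λ T → ∃ λ π → UpperBounds Q T π × LowerBound Q T π
    outcome Q = let (k , early , r) = Running.protocol-result s d n′ m Q (wide-enough c K n m m≤)
                in bounds Q k early r

    guarantees :
      ((Q : Items n m) → ∃ λ T → ∃ λ π → UpperBounds Q T π) ×
      (2 ≤ n → ∃ λ (Q : Items n m) → ∃ λ T → Halted 𝓐 Q T × n * m ≤ C * messages 𝓐 Q T)
    guarantees =
      (λ Q → let (T , π , uppers , _) = outcome Q in T , π , uppers) ,
      -- `messages-sent` is an exact count for every input, so any `Q` is a witness.
      (λ _ → let Q = λ _ _ → 0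
                 (T , π , (computes , _) , lower) = outcome Q
             in Q , T , (λ i → subst Is-just (sym (proj₁ (proj₂ (computes i)))) (just tt)) , lower)
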